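{- Let $S_{1,n-3}$ be the tree with vertices $v_0,v_1,\dots,v_{n-1}$ and edges $e_1=\{v_0,v_1\}$, $e_2=\{v_1,v_2\}$, $e_i=\{v_2,v_i\}$ for $3\le i\le n-1$. Let $B_1=\{e_1,\dots,e_{n-1},f_1,f_2\}$ with $f_1=\{v_0,v_2\}$, $f_2=\{v_1,v_3\}$, and $B_2=\{e_1,\dots,e_{n-1},f_1,f_2\}$ with $f_1=\{v_0,v_2\}$, $f_2=\{v_3,v_4\}$. Then: (1) the eigenvalues of $\mathfrak{D}_2(S_{1,n-3})[B_1,B_1]$ are $-1$ with multiplicity $n-5$ and the roots of $h_1(x)=x^6-2(n-1)x^5-3(7n-12)x^4-18(3n-7)x^3-5(9n-22)x^2-(13n-28)x-(n-1)$; (2) the eigenvalues of $\mathfrak{D}_2(S_{1,n-3})[B_2,B_2]$ are $-1$ with multiplicity $n-5$ and the roots of $h_2(x)=x^6-2(n-1)x^5-(21n-22)x^4-(62n-141)x^3-(53n-133)x^2-(15n-34)x-(n-1)$.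
   Context: For a tree $T$, let $\mathcal{V}_2$ be the set of 2-element vertex subsets (edges regarded as elements of $\mathcal{V}_2$). The 2-Steiner distance matrix $\mathfrak{D}_2(T)$ is indexed by $\mathcal{V}_2$, with entry in row $\{i,j\}$, column $\{k,l\}$ equal to the minimum number of edges of a connected subtree of $T$ whose vertex set contains $i,j,k,l$. $M[B,B]$ denotes the principal submatrix with rows and columns indexed by $B$. -}

module Defs where

open import Level using (_⊔_)
open import Algebra.Apartness.Bundles using (HeytingField; HeytingCommutativeRing)
import Algebra.Definitions.RawMonoid as RawMonoidDefs
import Algebra.Definitions.RawSemiring as RawSemiringDefs
open import Algebra.Bundles using (CommutativeRing; Semiring)
open import Data.Bool using (if_then_else_)
open import Data.Fin as Fin using (Fin; zero; suc; toℕ; punchIn)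
open import Data.Fin.Properties as Finₚ using (any?; all?)
open import Data.Fin.Subset using (Subset; _∈_; _∉_; ∣_∣; ⁅_⁆; _∪_; ⊤)
open import Data.Fin.Subset.Properties using (_∈?_; anySubset?; x∈⁅x⁆; x∈⁅y⁆⇒x≡y; x∈p∪q⁻; p⊂q⇒∣p∣<∣q∣; p⊆p∪q; q⊆p∪q; ∣p∣≤n; ∈⊤)
open import Data.List using (List; foldr; replicate; _++_)
import Data.List.Membership.Setoid as Membership
open import Data.Nat as ℕ using (ℕ; zero; suc; z≤n; s≤s; z<s; s<s)
open import Data.Nat.Properties as ℕₚ using ()
open import Data.Product using (Σ; ∃; _×_; _,_; proj₁; proj₂)
open import Data.Sum using (_⊎_; inj₁; inj₂)
open import Data.Vec.Functional as Vector using (Vector)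
open import Function.Bundles using (_⇔_)
open import Function.Definitions using (Injective)
open import Relation.Binary.Construct.Closure.ReflexiveTransitive using (Star; ε; _◅_; _◅◅_; reverse)
open import Relation.Binary.PropositionalEquality using (_≡_; refl; sym; trans; cong; subst)
open import Relation.Nullary using (Dec; yes; no; ¬_; does; contradiction)
open import Relation.Nullary.Decidable as Dec using (_×-dec_; _⊎-dec_; _→-dec_)
open import Relation.Unary using () renaming (Decidable to Decidable₁)

-- A 2-element subset of Fin n is represented by its increasing enumeration.
record 𝒱₂ (n : ℕ) : Set where
  constructor pair
  field
    lo hi  : Fin n
    .lo<hi : lo Fin.< hi

open 𝒱₂ public

private variable
  n : ℕ

Joins : 𝒱₂ n → Fin n → Fin n → Set
Joins e u v = (lo e ≡ u × hi e ≡ v) ⊎ (lo e ≡ v × hi e ≡ u)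

record Graph (n : ℕ) : Set where
  field
    size           : ℕ
    edge           : Fin size → 𝒱₂ n
    edge-injective : Injective _≡_ _≡_ edge

open Graph public

module _ (G : Graph n) where

  Adjacent : Subset (size G) → Fin n → Fin n → Set
  Adjacent F u v = ∃ λ e → e ∈ F × Joins (edge G e) u v

  IsSubgraph : Subset n → Subset (size G) → Set
  IsSubgraph W F = ∀ e → e ∈ F → lo (edge G e) ∈ W × hi (edge G e) ∈ W

  IsConnected : Subset n → Subset (size G) → Set
  IsConnected W F = ∀ u → u ∈ W → ∀ v → v ∈ W → Star (Adjacent F) u v

  -- A subgraph of a tree has no cycles, so when G is a tree its subtrees are
  -- exactly its (nonempty) connected subgraphs.
  IsSubtreeThrough : 𝒱₂ n → 𝒱₂ n → Subset n → Subset (size G) → Set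
  IsSubtreeThrough p q W F =
    IsSubgraph W F × IsConnected W F ×
    (lo p ∈ W × hi p ∈ W) × (lo q ∈ W × hi q ∈ W)

  SubtreeOfSize : 𝒱₂ n → 𝒱₂ n → ℕ → Set
  SubtreeOfSize p q d = ∃ λ W → ∃ λ F → IsSubtreeThrough p q W F × ∣ F ∣ ≡ d

  IsSteinerDistance : 𝒱₂ n → 𝒱₂ n → ℕ → Set
  IsSteinerDistance p q d =
    SubtreeOfSize p q d × (∀ d′ → SubtreeOfSize p q d′ → d ℕ.≤ d′)

Connected : Graph n → Set
Connected G = IsConnected G ⊤ ⊤

-- In a connected graph the minimum defining the Steiner distance is attained.
-- Only the type of steinerDistance matters; the proof is a finite search.
module _ (G : Graph n) where

  private

    joins? : ∀ e (u v : Fin n) → Dec (Joins e u v)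
    joins? e u v = (lo e Fin.≟ u ×-dec hi e Fin.≟ v) ⊎-dec (lo e Fin.≟ v ×-dec hi e Fin.≟ u)

    adjacent? : ∀ F u v → Dec (Adjacent G F u v)
    adjacent? F u v = any? λ e → (e ∈? F) ×-dec joins? (edge G e) u v

    Reached : Subset (size G) → Fin n → Subset n → Set
    Reached F u R = ∀ w → w ∈ R → Star (Adjacent G F) u w

    stays : ∀ F (R : Subset n) →
            ¬ (∃ λ w → w ∉ R × ∃ λ x → x ∈ R × Adjacent G F x w) →
            ∀ {x y} → x ∈ R → Star (Adjacent G F) x y → y ∈ R
    stays F R closed x∈R ε = x∈R
    stays F R closed x∈R (_◅_ {j = z} a as) with z ∈? R
    ... | yes z∈R = stays F R closed z∈R as
    ... | no  z∉R = contradiction (z , z∉R , _ , x∈R , a) closed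

    -- fuel bounds the number of vertices outside R
    explore : ∀ F u v (fuel : ℕ) (R : Subset n) → n ℕ.≤ fuel ℕ.+ ∣ R ∣ →
              u ∈ R → Reached F u R → Dec (Star (Adjacent G F) u v)
    explore F u v fuel R le u∈R reached
      with any? (λ w → Dec.¬? (w ∈? R) ×-dec any? λ x → (x ∈? R) ×-dec adjacent? F x w)
    ... | no closed with v ∈? R
    ...   | yes v∈R = yes (reached v v∈R)
    ...   | no  v∉R = no λ path → v∉R (stays F R closed u∈R path)
    explore F u v fuel R le u∈R reached | yes (w , w∉R , x , x∈R , a) = go fuel le
      where
      R′ : Subset n
      R′ = R ∪ ⁅ w ⁆

      bigger : ∣ R ∣ ℕ.< ∣ R′ ∣
      bigger = p⊂q⇒∣p∣<∣q∣ (p⊆p∪q ⁅ w ⁆ , w , q⊆p∪q R ⁅ w ⁆ (x∈⁅x⁆ w) , w∉R)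

      reached′ : Reached F u R′
      reached′ y y∈R′ with x∈p∪q⁻ R ⁅ w ⁆ y∈R′
      ... | inj₁ y∈R = reached y y∈R
      ... | inj₂ y∈w = subst (Star _ u) (sym (x∈⁅y⁆⇒x≡y w y∈w)) (reached x x∈R ◅◅ a ◅ ε)

      go : ∀ fuel → n ℕ.≤ fuel ℕ.+ ∣ R ∣ → Dec (Star (Adjacent G F) u v)
      go zero       le = contradiction (ℕₚ.≤-trans bigger (ℕₚ.≤-trans (∣p∣≤n R′) le)) (ℕₚ.<-irrefl refl)
      go (suc fuel) le = explore F u v fuel R′
        (ℕₚ.≤-trans le (ℕₚ.≤-trans (ℕₚ.≤-reflexive (sym (ℕₚ.+-suc fuel ∣ R ∣))) (ℕₚ.+-monoʳ-≤ fuel bigger)))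
        (p⊆p∪q ⁅ w ⁆ u∈R) reached′

    star? : ∀ F u v → Dec (Star (Adjacent G F) u v)
    star? F u v = explore F u v n ⁅ u ⁆ (ℕₚ.m≤m+n n _) (x∈⁅x⁆ u)
      λ w w∈ → subst (Star _ u) (sym (x∈⁅y⁆⇒x≡y u w∈)) ε

    subtreeOfSize? : ∀ p q d → Dec (SubtreeOfSize G p q d)
    subtreeOfSize? p q d = anySubset? λ W → anySubset? λ F →
      ((all? λ e → (e ∈? F) →-dec ((lo (edge G e) ∈? W) ×-dec (hi (edge G e) ∈? W)))
        ×-dec (all? λ u → (u ∈? W) →-dec all? λ v → (v ∈? W) →-dec star? F u v)
        ×-dec ((lo p ∈? W) ×-dec (hi p ∈? W))
        ×-dec ((lo q ∈? W) ×-dec (hi q ∈? W)))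
      ×-dec (∣ F ∣ ℕ.≟ d)

    least : {P : ℕ → Set} → Decidable₁ P → ∀ b → P b → ∃ λ d → P d × (∀ d′ → P d′ → d ℕ.≤ d′)
    least P? zero pb = zero , pb , λ _ _ → z≤n
    least {P} P? (suc b) pb with P? zero
    ... | yes p0 = zero , p0 , λ _ _ → z≤n
    ... | no ¬p0 with least (λ d → P? (suc d)) b pb
    ...   | d , pd , min = suc d , pd , λ where
            zero     p → contradiction p ¬p0
            (suc d′) p → s≤s (min d′ p)

  abstract
    steinerDistance : Connected G → ∀ p q → ∃ (IsSteinerDistance G p q)
    steinerDistance conn p q = least (subtreeOfSize? p q) ∣ ⊤ {size G} ∣
      (⊤ , ⊤ , ((λ _ _ → ∈⊤ , ∈⊤) , conn , (∈⊤ , ∈⊤) , (∈⊤ , ∈⊤)) , refl)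

𝔇₂ : (G : Graph n) → Connected G → 𝒱₂ n → 𝒱₂ n → ℕ
𝔇₂ G conn p q = proj₁ (steinerDistance G conn p q)

-- The tree S_{1,n-3} on n = 5 + k vertices: v_i is the element i of Fin n, and
-- e_i (for 1 ≤ i ≤ n - 1) is S-edge at index i - 1.
module _ (k : ℕ) where

  private
    v₀ v₁ v₂ v₃ v₄ : Fin (5 ℕ.+ k)
    v₀ = zero
    v₁ = suc zero
    v₂ = suc (suc zero)
    v₃ = suc (suc (suc zero))
    v₄ = suc (suc (suc (suc zero)))

  S-edge : Vector (𝒱₂ (5 ℕ.+ k)) (4 ℕ.+ k)
  S-edge zero          = pair v₀ v₁ z<s
  S-edge (suc zero)    = pair v₁ v₂ (s<s z<s)
  S-edge (suc (suc i)) = pair v₂ (suc (suc (suc i))) (s<s (s<s z<s))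

  S : Graph (5 ℕ.+ k)
  S = record { size = 4 ℕ.+ k ; edge = S-edge ; edge-injective = injective }
    where
    hi-S-edge : ∀ i → hi (S-edge i) ≡ suc i
    hi-S-edge zero          = refl
    hi-S-edge (suc zero)    = refl
    hi-S-edge (suc (suc i)) = refl

    injective : Injective _≡_ _≡_ S-edge
    injective {i} {j} eq = Finₚ.suc-injective
      (trans (sym (hi-S-edge i)) (trans (cong hi eq) (hi-S-edge j)))

  S-connected : Connected S
  S-connected u _ v _ = toCentre u ◅◅ reverse flip (toCentre v)
    where
    flip : ∀ {u v} → Adjacent S ⊤ u v → Adjacent S ⊤ v u
    flip (e , e∈ , inj₁ j) = e , e∈ , inj₂ j
    flip (e , e∈ , inj₂ j) = e , e∈ , inj₁ j

    toCentre : ∀ u → Star (Adjacent S ⊤) u v₂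
    toCentre zero                = (zero , ∈⊤ , inj₁ (refl , refl)) ◅ toCentre v₁
    toCentre (suc zero)          = (suc zero , ∈⊤ , inj₁ (refl , refl)) ◅ ε
    toCentre (suc (suc zero))    = ε
    toCentre (suc (suc (suc i))) = (suc (suc i) , ∈⊤ , inj₂ (refl , refl)) ◅ ε

  B₁ B₂ : Vector (𝒱₂ (5 ℕ.+ k)) (4 ℕ.+ k ℕ.+ 2)
  B₁ = S-edge Vector.++ (pair v₀ v₂ z<s Vector.∷ pair v₁ v₃ (s<s z<s) Vector.∷ Vector.[])
  B₂ = S-edge Vector.++ (pair v₀ v₂ z<s Vector.∷ pair v₃ v₄ (s<s (s<s (s<s z<s))) Vector.∷ Vector.[])

-- M [ B , B ] for a matrix M and an enumeration of the index set B without
-- repetitions; reordering the enumeration only conjugates by a permutation.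
_[_] : ∀ {a b} {I : Set a} {A : Set b} {m} → (I → I → A) → Vector I m → Fin m → Fin m → A
(M [ B ]) i j = M (B i) (B j)

module OverField {c ℓ₁ ℓ₂} (K : HeytingField c ℓ₁ ℓ₂) where

  open HeytingField K using (_#_; heytingCommutativeRing)
  open HeytingCommutativeRing heytingCommutativeRing using (commutativeRing)
  open CommutativeRing commutativeRing using (Carrier; _≈_; _+_; _*_; _-_; -_; 0#; 1#; +-rawMonoid; semiring; setoid)
  open RawMonoidDefs +-rawMonoid using (sum) renaming (_×_ to _·_)
  open RawSemiringDefs (Semiring.rawSemiring semiring) using (_^_)

  SquareMatrix : ℕ → Set c
  SquareMatrix m = Fin m → Fin m → Carrier

  ⟦_⟧ : ℕ → Carrier
  ⟦ m ⟧ = m · 1#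

  CharacteristicZero : Set ℓ₂
  CharacteristicZero = ∀ m → ⟦ suc m ⟧ # 0#

  fromℕ-matrix : ∀ {m} → (Fin m → Fin m → ℕ) → SquareMatrix m
  fromℕ-matrix A i j = ⟦ A i j ⟧

  -- Laplace expansion along the first row.
  det : ∀ {m} → SquareMatrix m → Carrier
  det {zero}  A = 1#
  det {suc m} A = sum λ j →
    (- 1#) ^ toℕ j * (A zero j * det (λ i l → A (suc i) (punchIn j l)))

  identity : ∀ {m} → SquareMatrix m
  identity i j = if does (i Fin.≟ j) then 1# else 0#

  -- The characteristic polynomial det (x I - A) as a function of x; over a
  -- field of characteristic zero, which is infinite, a polynomial is determined
  -- by its values.
  charPoly : ∀ {m} → SquareMatrix m → Carrier → Carrier
  charPoly A x = det λ i j → x * identity i j - A i j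

  IsEigenvalue : ∀ {m} → SquareMatrix m → Carrier → Set (c ⊔ ℓ₁ ⊔ ℓ₂)
  IsEigenvalue {m} A μ = Σ (Vector Carrier m) λ v →
    (∃ λ i → v i # 0#) × (∀ i → sum (λ j → A i j * v j) ≈ μ * v i)

  -- rs lists the roots of the monic polynomial p with multiplicity.
  RootsOf : (Carrier → Carrier) → List Carrier → Set (c ⊔ ℓ₁)
  RootsOf p rs = ∀ x → p x ≈ foldr (λ r y → (x - r) * y) 1# rs

  open Membership setoid using () renaming (_∈_ to _∈ₗ_)

  -- μs lists the eigenvalues of A with (algebraic) multiplicity.
  EigenvaluesOf : ∀ {m} → SquareMatrix m → List Carrier → Set (c ⊔ ℓ₁ ⊔ ℓ₂)
  EigenvaluesOf A μs = (∀ μ → IsEigenvalue A μ ⇔ μ ∈ₗ μs) × RootsOf (charPoly A) μs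

  -- The eigenvalues of A are μ with multiplicity k and the roots of h. The second
  -- component says this for fields in which h splits into linear factors; the
  -- first is the same count of multiplicities without assuming a splitting.
  EigenvaluesAre : ∀ {m} → SquareMatrix m → Carrier → ℕ → (Carrier → Carrier) → Set (c ⊔ ℓ₁ ⊔ ℓ₂)
  EigenvaluesAre A μ k h =
    (∀ x → charPoly A x ≈ (x - μ) ^ k * h x) ×
    (∀ rs → RootsOf h rs → EigenvaluesOf A (replicate k μ ++ rs))

  h₁ h₂ : ℕ → Carrier → Carrier
  h₁ n x = x ^ 6
    - ⟦ 2 ⟧ * (⟦ n ⟧ - 1#) * x ^ 5
    - ⟦ 3 ⟧ * (⟦ 7 ⟧ * ⟦ n ⟧ - ⟦ 12 ⟧) * x ^ 4
    - ⟦ 18 ⟧ * (⟦ 3 ⟧ * ⟦ n ⟧ - ⟦ 7 ⟧) * x ^ 3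
    - ⟦ 5 ⟧ * (⟦ 9 ⟧ * ⟦ n ⟧ - ⟦ 22 ⟧) * x ^ 2
    - (⟦ 13 ⟧ * ⟦ n ⟧ - ⟦ 28 ⟧) * x
    - (⟦ n ⟧ - 1#)
  h₂ n x = x ^ 6
    - ⟦ 2 ⟧ * (⟦ n ⟧ - 1#) * x ^ 5
    - (⟦ 21 ⟧ * ⟦ n ⟧ - ⟦ 22 ⟧) * x ^ 4
    - (⟦ 62 ⟧ * ⟦ n ⟧ - ⟦ 141 ⟧) * x ^ 3
    - (⟦ 53 ⟧ * ⟦ n ⟧ - ⟦ 133 ⟧) * x ^ 2
    - (⟦ 15 ⟧ * ⟦ n ⟧ - ⟦ 34 ⟧) * x
    - (⟦ n ⟧ - 1#)

{-# OPTIONS --safe #-}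

-- Unless both pairs are e₁, the smallest subtree containing two pairs of vertices
-- consists of the paths from these vertices to the centre v₂: an edge on one of
-- these paths separates two of the vertices, so every connected subgraph uses it.
--
-- Let y = x + 1. In x I - 𝔇₂[B,B] the rows of the leaf edges e₅, …, e_{n-1}
-- differ from the row of e₄ only in a few places, so subtracting the latter
-- gives a matrix [ P , w ; r , y I ] in which P is 6 × 6 and all columns of w
-- and all rows of r are equal. If y is invertible, Schur complements peel off
-- the diagonal y I and leave y^(n-5) det (P - (n-5) y⁻¹ w r), a 6 × 6
-- determinant which is evaluated by normalising polynomials. If y = 0 and n > 5,
-- two rows of x I - 𝔇₂[B,B] coincide. As the matrix is symmetric, eigenvectors
-- are the nonzero vectors in the left kernel of μ I - 𝔇₂[B,B]; by Gaussian
-- elimination there are such vectors exactly when the determinant vanishes.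
module Submission where

open import Defs
open import Algebra.Apartness.Bundles using (HeytingField; HeytingCommutativeRing)
open import Algebra.Bundles using (CommutativeRing)
import Algebra.Solver.Ring as RingSolver
open import Algebra.Solver.Ring.AlmostCommutativeRing using (fromCommutativeRing; _-Raw-AlmostCommutative⟶_)
open import Data.Bool using (true; false; if_then_else_; _∨_)
open import Data.Bool.Properties using (if-float)
open import Data.Fin as Fin using (Fin; zero; suc; toℕ; punchIn; punchOut; splitAt; _↑ˡ_; _↑ʳ_)
open import Data.Fin.Patterns
open import Data.Fin.Properties as Finₚ using (any?; punchInᵢ≢i; punchIn-punchOut)
open import Data.Fin.Subset using (Subset; inside; outside; _∈_; _∉_; _⊆_; ∣_∣; ⁅_⁆; _∪_; ⊥)
open import Data.Fin.Subset.Properties using (_∈?_; ∉⊥; x∈⁅x⁆; x∈⁅y⁆⇒x≡y; x∈p∪q⁻; p⊆p∪q; q⊆p∪q; p⊆q⇒∣p∣≤∣q∣; ∣⊥∣≡0; ∣⁅x⁆∣≡1; ∪-identityˡ; ∪-identityʳ; ∪-idem)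
open import Data.Integer as ℤ using (ℤ; +_; -[1+_]; +0; +[1+_]; _⊖_)
import Data.Integer.Properties as ℤₚ
open import Data.List using (List; []; _∷_; foldr; replicate) renaming (_++_ to _++ₗ_)
import Data.List.Membership.Setoid as Membership
open import Data.List.Relation.Unary.Any using (here; there)
open import Data.Maybe as Maybe using ()
open import Data.Nat as ℕ using (ℕ; zero; suc; s≤s; z≤n; z<s; s<s)
import Data.Nat.Properties as ℕₚ
open import Data.Product using (Σ; ∃; _×_; _,_; proj₁; proj₂)
open import Data.Sum as Sum using (_⊎_; inj₁; inj₂; [_,_]′)
import Data.Sum.Properties as Sumₚ
open import Data.Vec as Vec using (_∷_; [])
open import Data.Vec.Functional as Vector using (Vector; updateAt; insertAt)
open import Data.Vec.Functional.Properties using (updateAt-updates; updateAt-minimal; insertAt-lookup; insertAt-punchIn)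
open import Data.Vec.Properties using (zipWith-++)
open import Function using (_∘_; id; const; mk⇔)
open import Relation.Binary.Construct.Closure.ReflexiveTransitive using (Star; ε; _◅_; _◅◅_; reverse)
open import Relation.Binary.Definitions using (Decidable)
open import Relation.Binary.PropositionalEquality as ≡ using (_≡_; _≢_)
open import Relation.Nullary using (Dec; yes; no; ¬_; does; contradiction)
open import Relation.Nullary.Decidable using (_⊎-dec_; recompute; dec⇒maybe; dec-true; dec-false; does-⇔)

-- Polynomial identities over the field, with integer coefficients.

module Polynomials {c ℓ₁ ℓ₂} (K : HeytingField c ℓ₁ ℓ₂) where

  open OverField K
  open HeytingField K using (heytingCommutativeRing)
  open HeytingCommutativeRing heytingCommutativeRing using (commutativeRing)
  open CommutativeRing commutativeRing hiding (zero)
  open import Algebra.Properties.Semiring.Mult semiring using (×-homo-+; ×1-homo-*; ×-homo-1)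
  open import Algebra.Properties.Semiring.Exp semiring using (_^_)
  open import Algebra.Properties.Semiring.Sum semiring
  open import Algebra.Properties.Ring ring
  open import Algebra.Properties.AbelianGroup +-abelianGroup using (⁻¹-∙-comm; ε⁻¹≈ε)
  open import Relation.Binary.Reasoning.Setoid setoid

  fromℤ : ℤ → Carrier
  fromℤ (+ m)      = ⟦ m ⟧
  fromℤ (-[1+ m ]) = - ⟦ suc m ⟧

  private
    cancel₁ : ∀ a b → a - b ≈ (1# + a) - (1# + b)
    cancel₁ a b = sym (begin
      (1# + a) - (1# + b)      ≈⟨ +-congˡ (⁻¹-∙-comm 1# b) ⟨
      (1# + a) + (- 1# - b)    ≈⟨ +-congʳ (+-comm 1# a) ⟩
      (a + 1#) + (- 1# - b)    ≈⟨ +-assoc a 1# _ ⟩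
      a + (1# + (- 1# - b))    ≈⟨ +-congˡ (+-assoc 1# (- 1#) _) ⟨
      a + ((1# - 1#) - b)      ≈⟨ +-congˡ (+-congʳ (-‿inverseʳ 1#)) ⟩
      a + (0# - b)             ≈⟨ +-congˡ (+-identityˡ _) ⟩
      a - b                    ∎)

  fromℤ-⊖ : ∀ m n → fromℤ (m ⊖ n) ≈ ⟦ m ⟧ - ⟦ n ⟧
  fromℤ-⊖ m       zero    = sym (trans (+-congˡ ε⁻¹≈ε) (+-identityʳ _))
  fromℤ-⊖ zero    (suc n) = sym (+-identityˡ _)
  fromℤ-⊖ (suc m) (suc n) = begin
    fromℤ (suc m ⊖ suc n)       ≡⟨ ≡.cong fromℤ (ℤₚ.[1+m]⊖[1+n]≡m⊖n m n) ⟩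
    fromℤ (m ⊖ n)               ≈⟨ fromℤ-⊖ m n ⟩
    ⟦ m ⟧ - ⟦ n ⟧               ≈⟨ cancel₁ _ _ ⟩
    ⟦ suc m ⟧ - ⟦ suc n ⟧       ∎

  fromℤ-+ : ∀ i j → fromℤ (i ℤ.+ j) ≈ fromℤ i + fromℤ j
  fromℤ-+ (+ m)      (+ n)      = ×-homo-+ 1# m n
  fromℤ-+ (+ m)      (-[1+ n ]) = fromℤ-⊖ m (suc n)
  fromℤ-+ (-[1+ m ]) (+ n)      = trans (fromℤ-⊖ n (suc m)) (+-comm _ _)
  fromℤ-+ (-[1+ m ]) (-[1+ n ]) = begin
    - ⟦ suc (suc (m ℕ.+ n)) ⟧    ≡⟨ ≡.cong (λ z → - ⟦ suc z ⟧) (ℕₚ.+-suc m n) ⟨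
    - ⟦ suc m ℕ.+ suc n ⟧        ≈⟨ -‿cong (×-homo-+ 1# (suc m) (suc n)) ⟩
    - (⟦ suc m ⟧ + ⟦ suc n ⟧)    ≈⟨ ⁻¹-∙-comm _ _ ⟨
    - ⟦ suc m ⟧ - ⟦ suc n ⟧      ∎

  fromℤ-neg : ∀ i → fromℤ (ℤ.- i) ≈ - fromℤ i
  fromℤ-neg +0         = sym ε⁻¹≈ε
  fromℤ-neg +[1+ m ]   = refl
  fromℤ-neg (-[1+ m ]) = sym (-‿involutive _)

  fromℤ-*-pos : ∀ m j → fromℤ (+ m ℤ.* j) ≈ ⟦ m ⟧ * fromℤ j
  fromℤ-*-pos m (+ n)      = trans (reflexive (≡.cong fromℤ (≡.sym (ℤₚ.pos-* m n)))) (×1-homo-* m n)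
  fromℤ-*-pos m (-[1+ n ]) = begin
    fromℤ (+ m ℤ.* ℤ.- (+ suc n))   ≡⟨ ≡.cong fromℤ (ℤₚ.neg-distribʳ-* (+ m) (+ suc n)) ⟨
    fromℤ (ℤ.- (+ m ℤ.* + suc n))   ≈⟨ fromℤ-neg (+ m ℤ.* + suc n) ⟩
    - fromℤ (+ m ℤ.* + suc n)       ≈⟨ -‿cong (fromℤ-*-pos m (+ suc n)) ⟩
    - (⟦ m ⟧ * ⟦ suc n ⟧)           ≈⟨ -‿distribʳ-* _ _ ⟩
    ⟦ m ⟧ * - ⟦ suc n ⟧             ∎

  fromℤ-* : ∀ i j → fromℤ (i ℤ.* j) ≈ fromℤ i * fromℤ j
  fromℤ-* (+ m)      j = fromℤ-*-pos m j
  fromℤ-* (-[1+ m ]) j = begin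
    fromℤ (ℤ.- (+ suc m) ℤ.* j)     ≡⟨ ≡.cong fromℤ (ℤₚ.neg-distribˡ-* (+ suc m) j) ⟨
    fromℤ (ℤ.- (+ suc m ℤ.* j))     ≈⟨ fromℤ-neg (+ suc m ℤ.* j) ⟩
    - fromℤ (+ suc m ℤ.* j)         ≈⟨ -‿cong (fromℤ-*-pos (suc m) j) ⟩
    - (⟦ suc m ⟧ * fromℤ j)         ≈⟨ -‿distribˡ-* _ _ ⟩
    - ⟦ suc m ⟧ * fromℤ j           ∎

  fromℤ-morphism : ℤ.+-*-rawRing -Raw-AlmostCommutative⟶ fromCommutativeRing commutativeRing
  fromℤ-morphism = record
    { ⟦_⟧    = fromℤ
    ; +-homo = fromℤ-+
    ; *-homo = fromℤ-*
    ; -‿homo = fromℤ-neg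
    ; 0-homo = refl
    ; 1-homo = ×-homo-1 1#
    }

  -- Equality of integer coefficients is decidable, so normal forms can cancel terms although
  -- equality in the field need not compute.
  module Solver = RingSolver ℤ.+-*-rawRing (fromCommutativeRing commutativeRing) fromℤ-morphism
    (λ i j → Maybe.map (λ i≡j → reflexive (≡.cong fromℤ i≡j)) (dec⇒maybe (i ℤ.≟ j)))

  open Solver using (Polynomial; con; _:+_; _:*_; :-_; _:^_; normalise; correct)
    renaming (⟦_⟧ to ⟦_⟧ₚ; ⟦_⟧N to ⟦_⟧ₙ)

  -- Unlike con (+ 1), which evaluates to 1# + 0#, this evaluates to 1# judgementally.
  :1 : ∀ {v} → Polynomial v
  :1 = con (+ 1) :^ 0

  :sum : ∀ {v m} → Vector (Polynomial v) m → Polynomial v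
  :sum = Vector.foldr _:+_ (con (+ 0))

  :det : ∀ {v m} → (Fin m → Fin m → Polynomial v) → Polynomial v
  :det {m = zero}  A = :1
  :det {m = suc m} A = :sum λ j →
    (:- :1) :^ toℕ j :* (A zero j :* :det (λ i l → A (suc i) (punchIn j l)))

  ⟦:sum⟧ : ∀ {v m} (f : Vector (Polynomial v) m) ρ → ⟦ :sum f ⟧ₚ ρ ≡ sum (λ i → ⟦ f i ⟧ₚ ρ)
  ⟦:sum⟧ {m = zero}  f ρ = ≡.refl
  ⟦:sum⟧ {m = suc m} f ρ = ≡.cong (λ s → ⟦ f zero ⟧ₚ ρ + s) (⟦:sum⟧ (λ i → f (suc i)) ρ)

  -- Propositional equality suffices, since `:det` copies the recursion of `det` and its constants
  -- evaluate judgementally to `0#` and `1#`.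
  ⟦:det⟧ : ∀ {v m} (A : Fin m → Fin m → Polynomial v) ρ → ⟦ :det A ⟧ₚ ρ ≡ det (λ i j → ⟦ A i j ⟧ₚ ρ)
  ⟦:det⟧ {m = zero}  A ρ = ≡.refl
  ⟦:det⟧ {v} {suc m} A ρ = ≡.trans (⟦:sum⟧ term ρ) (sum-cong-≗ λ j →
    ≡.cong (λ d → (- 1#) ^ toℕ j * (⟦ A zero j ⟧ₚ ρ * d)) (⟦:det⟧ (λ i l → A (suc i) (punchIn j l)) ρ))
    where
    term : Vector (Polynomial v) (suc m)
    term j = (:- :1) :^ toℕ j :* (A zero j :* :det (λ i l → A (suc i) (punchIn j l)))

  -- This leaves only a comparison of integer normal forms, which is settled by computation for the
  -- two large determinants below.
  normalise-sound : ∀ {v} (p q : Polynomial v) → normalise p ≡ normalise q → ∀ ρ → ⟦ p ⟧ₚ ρ ≈ ⟦ q ⟧ₚ ρ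
  normalise-sound p q eq ρ = trans (sym (correct p ρ))
    (trans (reflexive (≡.cong (λ z → ⟦ z ⟧ₙ ρ) eq)) (correct q ρ))

-- Determinants: Laplace expansion, row operations and Schur complements.

-- The position of `c` among the indices that remain when `punchIn c l` is deleted. It serves to
-- delete two columns in the opposite order.
reinsert : ∀ {m} → Fin (suc m) → Fin m → Fin m
reinsert {suc m} zero    l       = zero
reinsert {suc m} (suc c) zero    = c
reinsert {suc m} (suc c) (suc l) = suc (reinsert c l)

punchIn-reinsert : ∀ {m} (c : Fin (suc m)) l → punchIn (punchIn c l) (reinsert c l) ≡ c
punchIn-reinsert {suc m} zero    l       = ≡.refl
punchIn-reinsert {suc m} (suc c) zero    = ≡.refl
punchIn-reinsert {suc m} (suc c) (suc l) = ≡.cong suc (punchIn-reinsert c l)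

punchIn-punchIn : ∀ {m} (c : Fin (suc (suc m))) l t →
  punchIn (punchIn c l) (punchIn (reinsert c l) t) ≡ punchIn c (punchIn l t)
punchIn-punchIn zero    l       t       = ≡.refl
punchIn-punchIn (suc c) zero    t       = ≡.refl
punchIn-punchIn (suc c) (suc l) zero    = ≡.refl
punchIn-punchIn (suc c) (suc l) (suc t) = ≡.cong suc (punchIn-punchIn c l t)

-- Supplies the row along which `det-equalRows` expands when there are at least three rows.
avoid₂ : ∀ {m} (a b : Fin (3 ℕ.+ m)) → ∃ λ r → r ≢ a × r ≢ b
avoid₂ 0F            0F            = 1F , (λ ()) , (λ ())
avoid₂ 0F            1F            = 2F , (λ ()) , (λ ())
avoid₂ 0F            (suc (suc _)) = 1F , (λ ()) , (λ ())
avoid₂ 1F            0F            = 2F , (λ ()) , (λ ())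
avoid₂ (suc (suc _)) 0F            = 1F , (λ ()) , (λ ())
avoid₂ (suc _)       (suc _)       = 0F , (λ ()) , (λ ())

module Determinant {c ℓ₁ ℓ₂} (K : HeytingField c ℓ₁ ℓ₂) where

  open OverField K
  open HeytingField K using (_#_; heytingCommutativeRing; #⇒invertible; tight)
  open HeytingCommutativeRing heytingCommutativeRing using (commutativeRing)
  open CommutativeRing commutativeRing hiding (zero)
  open import Algebra.Properties.Semiring.Exp semiring using (_^_; ^-homo-*)
  open import Algebra.Properties.Semiring.Sum semiring
  open import Algebra.Apartness.Properties.HeytingCommutativeRing heytingCommutativeRing using (1#0; x-0≈x)
  open import Relation.Binary.Reasoning.Setoid setoid
  open Polynomials K
  open Solver using (Polynomial; con; _:+_; _:*_; _:-_; :-_; solve; _:=_; normalise) renaming (⟦_⟧ to ⟦_⟧ₚ)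

  sgn : ℕ → Carrier
  sgn = (- 1#) ^_

  minor : ∀ {m n} → (Fin (suc m) → Fin (suc n) → Carrier) → Fin (suc m) → Fin (suc n) → Fin m → Fin n → Carrier
  minor A r c i l = A (punchIn r i) (punchIn c l)

  sum-zero : ∀ {m} (f : Vector Carrier m) → (∀ i → f i ≈ 0#) → sum f ≈ 0#
  sum-zero {m} f f≈0 = trans (sum-cong-≋ f≈0) (sum-replicate-zero m)

  sum-single : ∀ {m} (f : Vector Carrier (suc m)) i → (∀ l → f (punchIn i l) ≈ 0#) → sum f ≈ f i
  sum-single f i f≈0 = begin
    sum f                             ≈⟨ sum-remove f ⟩
    f i + sum (λ l → f (punchIn i l)) ≈⟨ +-congˡ (sum-zero _ f≈0) ⟩
    f i + 0#                          ≈⟨ +-identityʳ _ ⟩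
    f i                               ∎

  det-cong : ∀ {m} {A B : SquareMatrix m} → (∀ i j → A i j ≈ B i j) → det A ≈ det B
  det-cong {zero}  A≈B = refl
  det-cong {suc m} A≈B = sum-cong-≋ λ j →
    *-congˡ {(- 1#) ^ toℕ j} (*-cong (A≈B zero j) (det-cong λ i l → A≈B (suc i) (punchIn j l)))

  -- Both sides run over the ordered pairs of distinct indices: one fixes the first index and then
  -- the position of the second among the rest, the other does the reverse. The induction separates
  -- the pairs whose first index is zero (`a`), those whose second is zero (`b`), and the rest
  -- (`s`).
  sum-reinsert : ∀ {m} (g : Fin (suc m) → Fin m → Carrier) →
    sum (λ j → sum (g j)) ≈ sum (λ c → sum (λ l → g (punchIn c l) (reinsert c l)))
  sum-reinsert {zero}  g = refl
  sum-reinsert {suc m} g = begin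
    a + sum (λ j → g (suc j) zero + sum (λ l → g (suc j) (suc l)))
      ≈⟨ +-congˡ (∑-distrib-+ (λ j → g (suc j) zero) (λ j → sum (λ l → g (suc j) (suc l)))) ⟩
    a + (b + sum (λ j → sum (λ l → g (suc j) (suc l))))
      ≈⟨ +-congˡ (+-congˡ (sum-reinsert (λ j l → g (suc j) (suc l)))) ⟩
    a + (b + s)
      ≈⟨ solve 3 (λ a b s → a :+ (b :+ s) := b :+ (a :+ s)) refl a b s ⟩
    b + (a + s)
      ≈⟨ +-congˡ (∑-distrib-+ (g zero) (λ c → sum (λ l → g (suc (punchIn c l)) (suc (reinsert c l))))) ⟨
    sum (λ c → sum (λ l → g (punchIn c l) (reinsert c l))) ∎
    where
    a = sum (g zero)
    b = sum (λ j → g (suc j) zero)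
    s = sum (λ c → sum (λ l → g (suc (punchIn c l)) (suc (reinsert c l))))

  -- The exponents differ by one: if `l` is below `c`, the new positions are `l` and `c - 1`,
  -- otherwise they are `l + 1` and `c`.
  sgn-reinsert : ∀ {m} (c : Fin (suc m)) l →
    sgn (toℕ (punchIn c l)) * sgn (toℕ (reinsert c l)) ≈ - 1# * (sgn (toℕ c) * sgn (toℕ l))
  sgn-reinsert {suc m} zero    l       = solve 1 (λ s → :- :1 :* s :* :1 := :- :1 :* (:1 :* s)) refl (sgn (toℕ l))
  sgn-reinsert {suc m} (suc c) zero    = solve 1 (λ s → :1 :* s := :- :1 :* (:- :1 :* s :* :1)) refl (sgn (toℕ c))
  sgn-reinsert {suc m} (suc c) (suc l) = begin
    (- 1# * s₁) * (- 1# * s₂)      ≈⟨ solve 2 (λ s t → (:- :1 :* s) :* (:- :1 :* t) := s :* t) refl s₁ s₂ ⟩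
    s₁ * s₂                        ≈⟨ sgn-reinsert c l ⟩
    - 1# * (s₃ * s₄)               ≈⟨ solve 2 (λ s t → :- :1 :* (s :* t) := :- :1 :* ((:- :1 :* s) :* (:- :1 :* t))) refl s₃ s₄ ⟩
    - 1# * ((- 1# * s₃) * (- 1# * s₄)) ∎
    where
    s₁ = sgn (toℕ (punchIn c l))
    s₂ = sgn (toℕ (reinsert c l))
    s₃ = sgn (toℕ c)
    s₄ = sgn (toℕ l)

  -- For a later row, expand along row zero, expand each minor along the wanted row by induction,
  -- and exchange the order in which the two columns are deleted. The sign from `sgn-reinsert`
  -- accounts for the shift from `r` to `suc r`.
  laplace : ∀ {m} (A : SquareMatrix (suc m)) r →
    det A ≈ sum (λ c → sgn (toℕ r ℕ.+ toℕ c) * (A r c * det (minor A r c)))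
  laplace         A zero    = refl
  laplace {suc m} A (suc r) = begin
    det A
      ≈⟨ sum-cong-≋ (λ j → *-congˡ {sgn (toℕ j)} (*-congˡ {A zero j} (laplace (minor A zero j) r))) ⟩
    sum (λ j → sgn (toℕ j) * (A zero j * sum (t j)))
      ≈⟨ sum-cong-≋ (λ j → trans (*-congˡ (*-distribˡ-sum (A zero j) (t j))) (*-distribˡ-sum (sgn (toℕ j)) (λ c → A zero j * t j c))) ⟩
    sum (λ j → sum (g j))
      ≈⟨ sum-reinsert g ⟩
    sum (λ c → sum (λ l → g (punchIn c l) (reinsert c l)))
      ≈⟨ sum-cong-≋ (λ c → sum-cong-≋ (λ l → term c l)) ⟩
    sum (λ c → sum (λ l → sgn (toℕ (suc r) ℕ.+ toℕ c) * (A (suc r) c * u c l)))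
      ≈⟨ sum-cong-≋ (λ c → trans (*-congˡ (*-distribˡ-sum (A (suc r) c) (u c))) (*-distribˡ-sum (sgn (toℕ (suc r) ℕ.+ toℕ c)) (λ l → A (suc r) c * u c l))) ⟨
    sum (λ c → sgn (toℕ (suc r) ℕ.+ toℕ c) * (A (suc r) c * det (minor A (suc r) c))) ∎
    where
    t : Fin (suc (suc m)) → Fin (suc m) → Carrier
    t j c = sgn (toℕ r ℕ.+ toℕ c) * (A (suc r) (punchIn j c) * det (minor (minor A zero j) r c))

    g : Fin (suc (suc m)) → Fin (suc m) → Carrier
    g j c = sgn (toℕ j) * (A zero j * t j c)

    u : Fin (suc (suc m)) → Fin (suc m) → Carrier
    u c l = sgn (toℕ l) * (A zero (punchIn c l) * det (minor (minor A (suc r) c) zero l))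

    term : ∀ c l → g (punchIn c l) (reinsert c l) ≈ sgn (toℕ (suc r) ℕ.+ toℕ c) * (A (suc r) c * u c l)
    term c l = begin
      sj * (a * (sgn (toℕ r ℕ.+ toℕ (reinsert c l)) *
        (A (suc r) (punchIn (punchIn c l) (reinsert c l)) * det (minor (minor A zero (punchIn c l)) r (reinsert c l)))))
        ≈⟨ *-congˡ (*-congˡ (*-cong (^-homo-* (- 1#) (toℕ r) _) (*-cong
             (reflexive (≡.cong (A (suc r)) (punchIn-reinsert c l)))
             (det-cong λ i k → reflexive (≡.cong (A (suc (punchIn r i))) (punchIn-punchIn c l k)))))) ⟩
      sj * (a * ((sr * sc′) * (b * d)))
        ≈⟨ solve 6 (λ sj a sr sc′ b d → sj :* (a :* ((sr :* sc′) :* (b :* d))) := (sj :* sc′) :* (sr :* (a :* (b :* d)))) refl sj a sr sc′ b d ⟩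
      (sj * sc′) * (sr * (a * (b * d)))
        ≈⟨ *-congʳ (sgn-reinsert c l) ⟩
      (- 1# * (sc * sl)) * (sr * (a * (b * d)))
        ≈⟨ solve 6 (λ sc sl sr a b d → (:- :1 :* (sc :* sl)) :* (sr :* (a :* (b :* d))) := (:- :1 :* (sr :* sc)) :* (b :* (sl :* (a :* d)))) refl sc sl sr a b d ⟩
      (- 1# * (sr * sc)) * (b * (sl * (a * d)))
        ≈⟨ *-congʳ (*-congˡ (^-homo-* (- 1#) (toℕ r) (toℕ c))) ⟨
      sgn (toℕ (suc r) ℕ.+ toℕ c) * (b * (sl * (a * d))) ∎
      where
      sj  = sgn (toℕ (punchIn c l))
      sc′ = sgn (toℕ (reinsert c l))
      sr  = sgn (toℕ r)
      sc  = sgn (toℕ c)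
      sl  = sgn (toℕ l)
      a   = A zero (punchIn c l)
      b   = A (suc r) c
      d   = det (minor (minor A (suc r) c) zero l)

  -- Expanding along a third row leaves minors that still contain both equal rows, so the induction
  -- starts from explicit 2 × 2 determinants.
  det-equalRows : ∀ {m} (A : SquareMatrix m) {a b} → a ≢ b → (∀ c → A a c ≈ A b c) → det A ≈ 0#
  det-equalRows {suc zero}          A {0F} {0F} a≢b eq = contradiction ≡.refl a≢b
  det-equalRows {suc (suc zero)}    A {a} {b} a≢b eq = trans det₂ (vanish a b a≢b eq)
    where
    det₂ : det A ≈ A 0F 0F * A 1F 1F - A 0F 1F * A 1F 0F
    det₂ = solve 4 (λ a b c d →
      :1 :* (a :* (:1 :* (d :* :1) :+ con (+ 0))) :+ (:- :1 :* :1 :* (b :* (:1 :* (c :* :1) :+ con (+ 0))) :+ con (+ 0))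
        := a :* d :- b :* c) refl (A 0F 0F) (A 0F 1F) (A 1F 0F) (A 1F 1F)

    vanish : ∀ a b → a ≢ b → (∀ c → A a c ≈ A b c) → A 0F 0F * A 1F 1F - A 0F 1F * A 1F 0F ≈ 0#
    vanish 0F 0F a≢b _  = contradiction ≡.refl a≢b
    vanish 1F 1F a≢b _  = contradiction ≡.refl a≢b
    vanish 0F 1F _   eq = trans (+-congʳ (trans (*-cong (eq 0F) (sym (eq 1F))) (*-comm _ _))) (-‿inverseʳ _)
    vanish 1F 0F _   eq = trans (+-congʳ (trans (*-cong (sym (eq 0F)) (eq 1F)) (*-comm _ _))) (-‿inverseʳ _)
  det-equalRows {suc (suc (suc m))} A {a} {b} a≢b eq =
    let r , r≢a , r≢b = avoid₂ a b in
    trans (laplace A r) (sum-zero _ λ c → begin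
    sgn (toℕ r ℕ.+ toℕ c) * (A r c * det (minor A r c))
      ≈⟨ *-congˡ (*-congˡ (det-equalRows (minor A r c) {punchOut r≢a} {punchOut r≢b}
           (a≢b ∘ Finₚ.punchOut-injective r≢a r≢b)
           λ l → trans (reflexive (≡.cong (λ z → A z (punchIn c l)) (punchIn-punchOut r≢a)))
                   (trans (eq (punchIn c l))
                     (reflexive (≡.cong (λ z → A z (punchIn c l)) (≡.sym (punchIn-punchOut r≢b))))))) ⟩
    sgn (toℕ r ℕ.+ toℕ c) * (A r c * 0#)  ≈⟨ *-congˡ (zeroʳ _) ⟩
    sgn (toℕ r ℕ.+ toℕ c) * 0#            ≈⟨ zeroʳ _ ⟩
    0#                                    ∎)

  -- The sum is the expansion along row `q` of the matrix `E` in which row `q` is overwritten by row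
  -- `r`, and `E` has two equal rows.
  laplace-alien : ∀ {m} (A : SquareMatrix (suc m)) {r q} → q ≢ r →
    sum (λ c → sgn (toℕ q ℕ.+ toℕ c) * (A r c * det (minor A q c))) ≈ 0#
  laplace-alien A {r} {q} q≢r = begin
    sum (λ c → sgn (toℕ q ℕ.+ toℕ c) * (A r c * det (minor A q c)))
      ≈⟨ sum-cong-≋ (λ c → *-congˡ {sgn (toℕ q ℕ.+ toℕ c)} (*-cong
           (reflexive (≡.cong (λ z → A z c) (updateAt-updates q {const r} id)))
           (det-cong λ i l → reflexive (≡.cong (λ z → A z (punchIn c l)) (updateAt-minimal _ q {const r} id (punchInᵢ≢i q i)))))) ⟨
    sum (λ c → sgn (toℕ q ℕ.+ toℕ c) * (E q c * det (minor E q c)))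
      ≈⟨ laplace E q ⟨
    det E
      ≈⟨ det-equalRows E q≢r (λ c → reflexive (≡.cong (λ z → A z c)
           (≡.trans (updateAt-updates q id) (≡.sym (updateAt-minimal r q id (q≢r ∘ ≡.sym)))))) ⟩
    0# ∎
    where
    E : SquareMatrix _
    E i c = A (updateAt id q (const r) i) c

  -- All rows are changed at once, while `t r ≈ 0#` keeps row `r` itself fixed. In the expansion
  -- along a row `q` other than `r`, the minors contain row `r` and are restored by induction, and
  -- the summand added to row `q` gives an alien expansion.
  det-addRow : ∀ {m} (A : SquareMatrix m) r (t : Vector Carrier m) → t r ≈ 0# →
    det (λ i c → A i c + t i * A r c) ≈ det A
  det-addRow {suc zero}    A 0F t t≈0 = det-cong {A = λ i c → A i c + t i * A 0F c} {B = A} λ where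
    0F 0F → trans (+-congˡ {A 0F 0F} (trans (*-congʳ t≈0) (zeroˡ (A 0F 0F)))) (+-identityʳ (A 0F 0F))
  det-addRow {suc (suc m)} A r  t t≈0 = begin
    det A′
      ≈⟨ laplace A′ q ⟩
    sum (λ c → s c * (A′ q c * det (minor A′ q c)))
      ≈⟨ sum-cong-≋ (λ c → *-congˡ {s c} (*-congˡ {A′ q c} (trans
           (det-cong λ i l → +-congˡ {A (punchIn q i) (punchIn c l)} (*-congˡ {t (punchIn q i)}
             (reflexive (≡.cong (λ z → A z (punchIn c l)) (≡.sym r≡)))))
           (det-addRow (minor A q c) (punchOut q≢r) (t ∘ punchIn q) (trans (reflexive (≡.cong t r≡)) t≈0))))) ⟩
    sum (λ c → s c * (A′ q c * d c))
      ≈⟨ sum-cong-≋ (λ c → solve 5 (λ s a t b d → s :* ((a :+ t :* b) :* d) := s :* (a :* d) :+ t :* (s :* (b :* d))) refl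
           (s c) (A q c) (t q) (A r c) (d c)) ⟩
    sum (λ c → s c * (A q c * d c) + t q * (s c * (A r c * d c)))
      ≈⟨ ∑-distrib-+ (λ c → s c * (A q c * d c)) (λ c → t q * (s c * (A r c * d c))) ⟩
    sum (λ c → s c * (A q c * d c)) + sum (λ c → t q * (s c * (A r c * d c)))
      ≈⟨ +-cong (laplace A q) (*-distribˡ-sum (t q) (λ c → s c * (A r c * d c))) ⟨
    det A + t q * sum (λ c → s c * (A r c * d c))
      ≈⟨ +-congˡ (trans (*-congˡ (laplace-alien A q≢r)) (zeroʳ _)) ⟩
    det A + 0#
      ≈⟨ +-identityʳ _ ⟩
    det A ∎
    where
    q   = punchIn r zero
    q≢r = punchInᵢ≢i r zero
    r≡  = punchIn-punchOut q≢r

    A′ : SquareMatrix _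
    A′ i c = A i c + t i * A r c

    s d : Fin (suc (suc m)) → Carrier
    s c = sgn (toℕ q ℕ.+ toℕ c)
    d c = det (minor A q c)

  det-zeroColumn : ∀ {m} (A : SquareMatrix m) c → (∀ i → A i c ≈ 0#) → det A ≈ 0#
  det-zeroColumn {suc m} A c A≈0 = sum-zero _ term
    where
    term : ∀ j → sgn (toℕ j) * (A zero j * det (minor A zero j)) ≈ 0#
    term j with j Fin.≟ c
    ... | yes ≡.refl = trans (*-congˡ (trans (*-congʳ (A≈0 zero)) (zeroˡ _))) (zeroʳ _)
    ... | no j≢c     = trans (*-congˡ (trans (*-congˡ (det-zeroColumn (minor A zero j) (punchOut j≢c)
      λ i → trans (reflexive (≡.cong (A (suc i)) (punchIn-punchOut j≢c))) (A≈0 (suc i)))) (zeroʳ _))) (zeroʳ _)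

  -- The Schur complement of the entry in row `r` and column `c`, with `p` in place of its inverse.
  -- Rectangular matrices are allowed because it also drives the elimination for left kernels.
  schur : ∀ {m n} → (Fin (suc m) → Fin (suc n) → Carrier) → Fin (suc m) → Fin (suc n) → Carrier →
    Fin m → Fin n → Carrier
  schur A r c p i l = A (punchIn r i) (punchIn c l) - A (punchIn r i) c * p * A r (punchIn c l)

  -- Multiples of row `r` clear the rest of column `c`. In the expansion along row `r`, every minor
  -- that retains column `c` then has a zero column, so one term survives.
  det-schur : ∀ {m} (A : SquareMatrix (suc m)) r c p → A r c * p ≈ 1# →
    det A ≈ sgn (toℕ r ℕ.+ toℕ c) * (A r c * det (schur A r c p))
  det-schur {m} A r c p Ap≈1 = begin
    det A
      ≈⟨ det-addRow A r t (reflexive (updateAt-updates r _)) ⟨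
    det A′
      ≈⟨ laplace A′ r ⟩
    sum (λ l → sgn (toℕ r ℕ.+ toℕ l) * (A′ r l * det (minor A′ r l)))
      ≈⟨ sum-single (λ l → sgn (toℕ r ℕ.+ toℕ l) * (A′ r l * det (minor A′ r l))) c
           (λ l → trans (*-congˡ (trans (*-congˡ (others l)) (zeroʳ _))) (zeroʳ _)) ⟩
    sgn (toℕ r ℕ.+ toℕ c) * (A′ r c * det (minor A′ r c))
      ≈⟨ *-congˡ (*-cong row-r (det-cong λ i l → trans (rows i (punchIn c l)) (+-congˡ
           (solve 3 (λ a p b → :- (a :* p) :* b := :- (a :* p :* b)) refl _ p _)))) ⟩
    sgn (toℕ r ℕ.+ toℕ c) * (A r c * det (schur A r c p)) ∎
    where
    t : Vector Carrier (suc m)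
    t = updateAt (λ i → - (A i c * p)) r (const 0#)

    A′ : SquareMatrix (suc m)
    A′ i l = A i l + t i * A r l

    row-r : A′ r c ≈ A r c
    row-r = trans (+-congˡ (trans (*-congʳ (reflexive (updateAt-updates r _))) (zeroˡ _))) (+-identityʳ _)

    rows : ∀ i l → A′ (punchIn r i) l ≈ A (punchIn r i) l + - (A (punchIn r i) c * p) * A r l
    rows i l = +-congˡ (*-congʳ (reflexive (updateAt-minimal _ r _ (punchInᵢ≢i r i))))

    column-c : ∀ i → A′ (punchIn r i) c ≈ 0#
    column-c i = begin
      A′ (punchIn r i) c              ≈⟨ rows i c ⟩
      a + - (a * p) * A r c           ≈⟨ solve 3 (λ a p b → a :+ :- (a :* p) :* b := a :- a :* (b :* p)) refl a p (A r c) ⟩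
      a - a * (A r c * p)             ≈⟨ +-congˡ (-‿cong (trans (*-congˡ Ap≈1) (*-identityʳ a))) ⟩
      a - a                           ≈⟨ -‿inverseʳ a ⟩
      0#                              ∎
      where a = A (punchIn r i) c

    others : ∀ l → det (minor A′ r (punchIn c l)) ≈ 0#
    others l = det-zeroColumn (minor A′ r (punchIn c l)) (reinsert c l) λ i →
      trans (reflexive (≡.cong (A′ (punchIn r i)) (punchIn-reinsert c l))) (column-c i)

  -- det is kept from unfolding on matrices whose size is not a variable, where
  -- comparing determinants would expand them into products.
  abstract

    Det : ∀ {m} → SquareMatrix m → Carrier
    Det = det

    charPoly≈Det : ∀ {m} (A : SquareMatrix m) x → charPoly A x ≈ Det (λ i j → x * identity i j - A i j)
    charPoly≈Det A x = refl

    Det-cong : ∀ {m} {A B : SquareMatrix m} → (∀ i j → A i j ≈ B i j) → Det A ≈ Det B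
    Det-cong = det-cong

    Det-equalRows : ∀ {m} (A : SquareMatrix m) {a b} → a ≢ b → (∀ c → A a c ≈ A b c) → Det A ≈ 0#
    Det-equalRows = det-equalRows

    Det-addRow : ∀ {m} (A : SquareMatrix m) r (t : Vector Carrier m) → t r ≈ 0# →
      Det (λ i c → A i c + t i * A r c) ≈ Det A
    Det-addRow = det-addRow

    Det-schur : ∀ {m} (A : SquareMatrix (suc m)) r c p → A r c * p ≈ 1# →
      Det A ≈ sgn (toℕ r ℕ.+ toℕ c) * (A r c * Det (schur A r c p))
    Det-schur = det-schur

    Det-normalise : ∀ {v m} (A : Fin m → Fin m → Polynomial v) q → normalise (:det A) ≡ normalise q →
      ∀ ρ → Det (λ i j → ⟦ A i j ⟧ₚ ρ) ≈ ⟦ q ⟧ₚ ρ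
    Det-normalise A q eq ρ = trans (reflexive (≡.sym (⟦:det⟧ A ρ))) (normalise-sound (:det A) q eq ρ)

  -- Left kernels and vanishing determinants.

  -- Relations between rows fit the row expansions above, so invariance of `det` under transposition
  -- does not enter.
  LeftKernel : ∀ {m n} → (Fin m → Fin n → Carrier) → Set _
  LeftKernel {m} A = Σ (Vector Carrier m) λ v →
    (∃ λ i → v i # 0#) × (∀ c → sum (λ i → v i * A i c) ≈ 0#)

  #0⇒inverse : ∀ {x} → x # 0# → ∃ λ p → x * p ≈ 1#
  #0⇒inverse {x} x#0 with #⇒invertible x#0
  ... | p , _ , xp≈1 = p , trans (*-congʳ (sym (x-0≈x x))) xp≈1

  *-cancelˡ-unit : ∀ {x p} → x * p ≈ 1# → ∀ {y} → x * y ≈ 0# → y ≈ 0#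
  *-cancelˡ-unit {x} {p} xp≈1 {y} xy≈0 = begin
    y             ≈⟨ *-identityˡ y ⟨
    1# * y        ≈⟨ *-congʳ xp≈1 ⟨
    (x * p) * y   ≈⟨ solve 3 (λ x p y → (x :* p) :* y := p :* (x :* y)) refl x p y ⟩
    p * (x * y)   ≈⟨ *-congˡ xy≈0 ⟩
    p * 0#        ≈⟨ zeroʳ p ⟩
    0#            ∎

  -- `F j` is the expansion along row `i` with the entries of row `j` put in. It is `det A` for
  -- `j = i` and zero otherwise, so `v i * det A` equals a double sum which, summed over `j` first,
  -- contains the vanishing columns of `v A`. Finally `v i` is cancelled.
  leftKernel⇒det≈0 : ∀ {m} (A : SquareMatrix m) → LeftKernel A → det A ≈ 0#
  leftKernel⇒det≈0 {suc m} A (v , (i , vi#0) , vA≈0) = *-cancelˡ-unit (proj₂ (#0⇒inverse vi#0)) (begin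
    v i * det A
      ≈⟨ *-congˡ (laplace A i) ⟩
    v i * F i
      ≈⟨ sum-single (λ j → v j * F j) i (λ l → trans (*-congˡ (laplace-alien A (punchInᵢ≢i i l ∘ ≡.sym))) (zeroʳ _)) ⟨
    sum (λ j → v j * F j)
      ≈⟨ sum-cong-≋ (λ j → *-distribˡ-sum (v j) (λ c → s c * (A j c * d c))) ⟩
    sum (λ j → sum (λ c → v j * (s c * (A j c * d c))))
      ≈⟨ ∑-comm (λ j c → v j * (s c * (A j c * d c))) ⟩
    sum (λ c → sum (λ j → v j * (s c * (A j c * d c))))
      ≈⟨ sum-zero _ column ⟩
    0# ∎)
    where
    s d F : Fin (suc m) → Carrier
    s c = sgn (toℕ i ℕ.+ toℕ c)
    d c = det (minor A i c)
    F j = sum (λ c → s c * (A j c * d c))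

    column : ∀ c → sum (λ j → v j * (s c * (A j c * d c))) ≈ 0#
    column c = begin
      sum (λ j → v j * (s c * (A j c * d c)))
        ≈⟨ sum-cong-≋ (λ j → solve 4 (λ v s a d → v :* (s :* (a :* d)) := (s :* d) :* (v :* a)) refl (v j) (s c) (A j c) (d c)) ⟩
      sum (λ j → (s c * d c) * (v j * A j c))
        ≈⟨ *-distribˡ-sum (s c * d c) (λ j → v j * A j c) ⟨
      (s c * d c) * sum (λ j → v j * A j c)
        ≈⟨ trans (*-congˡ (vA≈0 c)) (zeroʳ _) ⟩
      0# ∎

  -- Back substitution: outside column `c`, combining the rows of `A` with the extended vector
  -- amounts to combining the rows of the Schur complement.
  leftKernel-schur : ∀ {m n} (A : Fin (suc m) → Fin (suc n) → Carrier) r c p → A r c * p ≈ 1# →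
    LeftKernel (schur A r c p) → LeftKernel A
  leftKernel-schur {m} A r c p Ap≈1 (w , (i , wi#0) , wS≈0) =
    v , (punchIn r i , ≡.subst (_# 0#) (≡.sym (insertAt-punchIn w r _ i)) wi#0) , vA≈0
    where
    S₀ : Carrier
    S₀ = sum (λ i → w i * A (punchIn r i) c)

    v : Vector Carrier (suc m)
    -- The coefficient of row `r` is forced by column `c`, to which the other rows contribute `S₀`.
    v = insertAt w r (- S₀ * p)

    split : ∀ d → sum (λ i → v i * A i d) ≈ - S₀ * p * A r d + sum (λ i → w i * A (punchIn r i) d)
    split d = trans (sum-remove {i = r} (λ i → v i * A i d)) (+-cong
      (*-congʳ (reflexive (insertAt-lookup w r _)))
      (sum-cong-≋ λ i → *-congʳ (reflexive (insertAt-punchIn w r _ i))))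

    column-c : sum (λ i → v i * A i c) ≈ 0#
    column-c = begin
      sum (λ i → v i * A i c)    ≈⟨ split c ⟩
      - S₀ * p * A r c + S₀      ≈⟨ solve 3 (λ s p a → :- s :* p :* a :+ s := s :- s :* (a :* p)) refl S₀ p (A r c) ⟩
      S₀ - S₀ * (A r c * p)      ≈⟨ +-congˡ (-‿cong (trans (*-congˡ Ap≈1) (*-identityʳ S₀))) ⟩
      S₀ - S₀                    ≈⟨ -‿inverseʳ S₀ ⟩
      0#                         ∎

    others : ∀ l → sum (λ i → v i * A i (punchIn c l)) ≈ 0#
    others l = begin
      sum (λ i → v i * A i (punchIn c l))
        ≈⟨ split (punchIn c l) ⟩
      - S₀ * p * b + sum (λ i → w i * a i)
        ≈⟨ solve 4 (λ s p b t → :- s :* p :* b :+ t := t :+ (:- (p :* b)) :* s) refl S₀ p b _ ⟩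
      sum (λ i → w i * a i) + - (p * b) * S₀
        ≈⟨ +-congˡ (*-distribˡ-sum (- (p * b)) (λ i → w i * A (punchIn r i) c)) ⟩
      sum (λ i → w i * a i) + sum (λ i → - (p * b) * (w i * A (punchIn r i) c))
        ≈⟨ ∑-distrib-+ (λ i → w i * a i) _ ⟨
      sum (λ i → w i * a i + - (p * b) * (w i * A (punchIn r i) c))
        ≈⟨ sum-cong-≋ (λ i → solve 5 (λ w a p b e → w :* a :+ :- (p :* b) :* (w :* e) := w :* (a :- e :* p :* b)) refl
             (w i) (a i) p b (A (punchIn r i) c)) ⟩
      sum (λ i → w i * schur A r c p i l)
        ≈⟨ wS≈0 l ⟩
      0# ∎
      where
      b = A r (punchIn c l)
      a : Fin m → Carrier
      a i = A (punchIn r i) (punchIn c l)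

    vA≈0 : ∀ d → sum (λ i → v i * A i d) ≈ 0#
    vA≈0 d with c Fin.≟ d
    ... | yes ≡.refl = column-c
    ... | no c≢d     = ≡.subst (λ z → sum (λ i → v i * A i z) ≈ 0#) (punchIn-punchOut c≢d) (others (punchOut c≢d))

  module _ (_#?_ : Decidable _#_) where

    ¬#⇒≈ : ∀ {x y} → ¬ x # y → x ≈ y
    ¬#⇒≈ = proj₁ (tight _ _)

    -- Elimination on a matrix with one row more than columns. A zero first column is dropped
    -- together with the first row, which gets coefficient zero, so the excess of one row is
    -- preserved.
    underdetermined : ∀ {m} (A : Fin (suc m) → Fin m → Carrier) → LeftKernel A
    underdetermined {zero}  A = (λ _ → 1#) , (zero , 1#0) , λ ()
    underdetermined {suc m} A with any? (λ i → A i zero #? 0#)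
    ... | yes (r , Ar#0) = let p , Ap≈1 = #0⇒inverse Ar#0 in
      leftKernel-schur A r zero p Ap≈1 (underdetermined (schur A r zero p))
    ... | no all≈0 with underdetermined (λ i l → A (suc i) (suc l))
    ...   | w , (i , wi#0) , wA≈0 = 0# Vector.∷ w , (suc i , wi#0) , λ where
      zero    → sum-zero (λ i → (0# Vector.∷ w) i * A i zero) λ i → trans (*-congˡ (¬#⇒≈ λ Ai#0 → all≈0 (i , Ai#0))) (zeroʳ _)
      (suc l) → trans (+-cong (zeroˡ _) (wA≈0 l)) (+-identityʳ _)

    -- With a pivot in the first column, the Schur complement again has determinant zero, as the
    -- sign and the pivot cancel. If the first column is zero, the other columns form a matrix with
    -- one row too many.
    det≈0⇒leftKernel : ∀ {m} (A : SquareMatrix m) → det A ≈ 0# → LeftKernel A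
    det≈0⇒leftKernel {zero}  A 1≈0 = contradiction 1#0 (proj₂ (tight _ _) 1≈0)
    det≈0⇒leftKernel {suc m} A detA≈0 with any? (λ i → A i zero #? 0#)
    ... | yes (r , Ar#0) = let p , Ap≈1 = #0⇒inverse Ar#0 in
      leftKernel-schur A r zero p Ap≈1 (det≈0⇒leftKernel (schur A r zero p)
        (*-cancelˡ-unit Ap≈1 (sgn-cancel (toℕ r ℕ.+ 0) (trans (sym (det-schur A r zero p Ap≈1)) detA≈0))))
      where
      sgn-cancel : ∀ m {y} → sgn m * y ≈ 0# → y ≈ 0#
      sgn-cancel zero    {y} y≈0 = trans (sym (*-identityˡ y)) y≈0
      sgn-cancel (suc m) {y} y≈0 = sgn-cancel m (begin
        sgn m * y               ≈⟨ solve 2 (λ s y → s :* y := :- ((:- :1 :* s) :* y)) refl (sgn m) y ⟩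
        - (- 1# * sgn m * y)    ≈⟨ -‿cong y≈0 ⟩
        - 0#                    ≈⟨ solve 0 (:- con (+ 0) := con (+ 0)) refl ⟩
        0#                      ∎)
    ... | no all≈0 with underdetermined (λ i l → A i (suc l))
    ...   | v , v#0 , vA≈0 = v , v#0 , λ where
      zero    → sum-zero (λ i → v i * A i zero) λ i → trans (*-congˡ (¬#⇒≈ λ Ai#0 → all≈0 (i , Ai#0))) (zeroʳ _)
      (suc l) → vA≈0 l

-- Eigenvalues of symmetric matrices as roots of the characteristic polynomial.

module Eigenvalues {c ℓ₁ ℓ₂} (K : HeytingField c ℓ₁ ℓ₂) (_#?_ : Decidable (HeytingField._#_ K)) where

  open OverField K
  open HeytingField K using (heytingCommutativeRing; #⇒invertible; tight)
  open HeytingCommutativeRing heytingCommutativeRing using (commutativeRing)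
  open CommutativeRing commutativeRing hiding (zero)
  open import Algebra.Properties.Semiring.Exp semiring using (_^_)
  open import Algebra.Properties.Semiring.Sum semiring
  open import Algebra.Apartness.Properties.HeytingCommutativeRing heytingCommutativeRing using (1#0)
  open import Algebra.Properties.AbelianGroup +-abelianGroup using (x∙y⁻¹≈ε⇒x≈y)
  open import Relation.Binary.Reasoning.Setoid setoid
  open Membership setoid using () renaming (_∈_ to _∈ₗ_)
  open Polynomials K
  open Determinant K
  open Solver using (_:+_; _:*_; _:-_; :-_; solve; _:=_)

  Symmetric : ∀ {m} → SquareMatrix m → Set _
  Symmetric A = ∀ i j → A i j ≈ A j i

  linearFactors : List Carrier → Carrier → Carrier
  linearFactors rs x = foldr (λ r y → (x - r) * y) 1# rs

  identity-diagonal : ∀ {m} (i : Fin m) → identity i i ≡ 1#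
  identity-diagonal i = ≡.cong (if_then 1# else 0#) (dec-true (i Fin.≟ i) ≡.refl)

  identity-offDiagonal : ∀ {m} {i j : Fin m} → i ≢ j → identity i j ≡ 0#
  identity-offDiagonal {i = i} {j} i≢j = ≡.cong (if_then 1# else 0#) (dec-false (i Fin.≟ j) i≢j)

  -- Symmetry turns the combination of rows by `v` into the product of the matrix with the column
  -- `v`; hence left kernel vectors and eigenvectors agree.
  charMatrix-action : ∀ {m} (A : SquareMatrix m) → Symmetric A → ∀ μ (v : Vector Carrier m) c →
    sum (λ i → v i * (μ * identity i c - A i c)) ≈ μ * v c - sum (λ j → A c j * v j)
  charMatrix-action {suc m} A sym-A μ v c = begin
    sum (λ i → v i * (μ * identity i c - A i c))
      ≈⟨ sum-cong-≋ (λ i → trans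
           (solve 4 (λ v μ e a → v :* (μ :* e :- a) := μ :* (v :* e) :+ :- :1 :* (a :* v)) refl (v i) μ (identity i c) (A i c))
           (+-congˡ {μ * (v i * identity i c)} (*-congˡ { - 1#} (*-congʳ {v i} (sym-A i c))))) ⟩
    sum (λ i → μ * (v i * identity i c) + - 1# * (A c i * v i))
      ≈⟨ ∑-distrib-+ (λ i → μ * (v i * identity i c)) (λ i → - 1# * (A c i * v i)) ⟩
    sum (λ i → μ * (v i * identity i c)) + sum (λ i → - 1# * (A c i * v i))
      ≈⟨ +-cong (sum-single (λ i → μ * (v i * identity i c)) c λ l →
           trans (*-congˡ (trans (*-congˡ (reflexive (identity-offDiagonal (punchInᵢ≢i c l)))) (zeroʳ _))) (zeroʳ _))
           (sym (*-distribˡ-sum (- 1#) (λ i → A c i * v i))) ⟩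
    μ * (v c * identity c c) + - 1# * sum (λ j → A c j * v j)
      ≈⟨ +-congʳ (*-congˡ (*-congˡ (reflexive (identity-diagonal c)))) ⟩
    μ * (v c * 1#) + - 1# * sum (λ j → A c j * v j)
      ≈⟨ solve 3 (λ μ v s → μ :* (v :* :1) :+ :- :1 :* s := μ :* v :- s) refl μ (v c) _ ⟩
    μ * v c - sum (λ j → A c j * v j) ∎

  -- A factor with `x # r` is invertible and can be cancelled, so some other factor must vanish.
  linearFactors≈0⇒∈ : ∀ x rs → linearFactors rs x ≈ 0# → x ∈ₗ rs
  linearFactors≈0⇒∈ x []       1≈0 = contradiction 1#0 (proj₂ (tight _ _) 1≈0)
  linearFactors≈0⇒∈ x (r ∷ rs) p≈0 with x #? r
  ... | yes x#r = there (linearFactors≈0⇒∈ x rs (*-cancelˡ-unit (proj₂ (proj₂ (#⇒invertible x#r))) p≈0))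
  ... | no ¬x#r = here (proj₁ (tight _ _) ¬x#r)

  ∈⇒linearFactors≈0 : ∀ x rs → x ∈ₗ rs → linearFactors rs x ≈ 0#
  ∈⇒linearFactors≈0 x (r ∷ rs) (here x≈r)   = trans (*-congʳ (trans (+-congʳ x≈r) (-‿inverseʳ r))) (zeroˡ _)
  ∈⇒linearFactors≈0 x (r ∷ rs) (there x∈rs) = trans (*-congˡ (∈⇒linearFactors≈0 x rs x∈rs)) (zeroʳ _)

  eigenvaluesOf-roots : ∀ {m} (A : SquareMatrix m) → Symmetric A → ∀ μs → RootsOf (charPoly A) μs → EigenvaluesOf A μs
  eigenvaluesOf-roots A sym-A μs roots = (λ μ → mk⇔ (⇒∈ μ) (∈⇒ μ)) , roots
    where
    ⇒∈ : ∀ μ → IsEigenvalue A μ → μ ∈ₗ μs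
    ⇒∈ μ (v , v#0 , Av≈μv) = linearFactors≈0⇒∈ μ μs (trans (sym (roots μ)) (leftKernel⇒det≈0 _
      (v , v#0 , λ c → trans (charMatrix-action A sym-A μ v c) (trans (+-congˡ (-‿cong (Av≈μv c))) (-‿inverseʳ _)))))

    ∈⇒ : ∀ μ → μ ∈ₗ μs → IsEigenvalue A μ
    ∈⇒ μ μ∈μs with det≈0⇒leftKernel _#?_ _ (trans (roots μ) (∈⇒linearFactors≈0 μ μs μ∈μs))
    ... | v , v#0 , vC≈0 = v , v#0 , λ i →
      sym (x∙y⁻¹≈ε⇒x≈y _ _ (trans (sym (charMatrix-action A sym-A μ v i)) (vC≈0 i)))

  linearFactors-replicate-++ : ∀ k μ rs x → linearFactors (replicate k μ ++ₗ rs) x ≈ (x - μ) ^ k * linearFactors rs x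
  linearFactors-replicate-++ zero    μ rs x = sym (*-identityˡ _)
  linearFactors-replicate-++ (suc k) μ rs x = trans (*-congˡ (linearFactors-replicate-++ k μ rs x)) (sym (*-assoc _ _ _))

  charPoly⇒eigenvaluesAre : ∀ {m} (A : SquareMatrix m) → Symmetric A → ∀ μ k h →
    (∀ x → charPoly A x ≈ (x - μ) ^ k * h x) → EigenvaluesAre A μ k h
  charPoly⇒eigenvaluesAre A sym-A μ k h eq = eq , λ rs roots →
    eigenvaluesOf-roots A sym-A (replicate k μ ++ₗ rs) λ x →
      trans (eq x) (trans (*-congˡ (roots x)) (sym (linearFactors-replicate-++ k μ rs x)))

-- Steiner distances in the tree.

module SteinerDistance where

  open ≡ using (refl; sym; trans; cong; cong₂; subst; subst₂; module ≡-Reasoning)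
  open Vec using (_++_; here; there)

  lo≢hi : ∀ {n} (p : 𝒱₂ n) → lo p ≢ hi p
  lo≢hi (pair l h l<h) l≡h = Finₚ.<⇒≢ (recompute (l Fin.<? h) l<h) l≡h

  module _ {n} (G : Graph n) where

    Adjacent-sym : ∀ {F u v} → Adjacent G F u v → Adjacent G F v u
    Adjacent-sym (e , e∈F , j) = e , e∈F , Sum.swap j

    IsSteinerDistance-unique : ∀ p q {d d′} → IsSteinerDistance G p q d → IsSteinerDistance G p q d′ → d ≡ d′
    IsSteinerDistance-unique p q (t , min) (t′ , min′) = ℕₚ.≤-antisym (min _ t′) (min′ _ t)

    IsSteinerDistance-sym : ∀ p q {d} → IsSteinerDistance G p q d → IsSteinerDistance G q p d
    IsSteinerDistance-sym p q (t , min) = swap p q t , λ d′ t′ → min d′ (swap q p t′)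
      where
      swap : ∀ p q {d} → SubtreeOfSize G p q d → SubtreeOfSize G q p d
      swap p q (W , F , (sub , con , p∈ , q∈) , eq) = W , F , (sub , con , q∈ , p∈) , eq

    module _ (conn : Connected G) where

      𝔇₂-correct : ∀ p q → IsSteinerDistance G p q (𝔇₂ G conn p q)
      𝔇₂-correct p q = proj₂ (steinerDistance G conn p q)

      𝔇₂-sym : ∀ p q → 𝔇₂ G conn p q ≡ 𝔇₂ G conn q p
      𝔇₂-sym p q = IsSteinerDistance-unique p q (𝔇₂-correct p q) (IsSteinerDistance-sym q p (𝔇₂-correct q p))

  -- The edges of the path in S k from a vertex to the centre v₂.
  path : ∀ {k} → Fin (5 ℕ.+ k) → Subset (4 ℕ.+ k)
  path 0F                  = inside  ∷ inside  ∷ ⊥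
  path 1F                  = outside ∷ inside  ∷ ⊥
  path 2F                  = ⊥
  path (suc (suc (suc i))) = outside ∷ outside ∷ ⁅ i ⁆

  paths : ∀ {k} → 𝒱₂ (5 ℕ.+ k) → Subset (4 ℕ.+ k)
  paths p = path (lo p) ∪ path (hi p)

  module _ {k : ℕ} where

    private
      Vertices : Set
      Vertices = Subset (5 ℕ.+ k)

      Edges : Set
      Edges = Subset (4 ℕ.+ k)

    -- The paths to the centre from the two ends of an edge differ by that edge only.
    crosses : ∀ e′ {e u v} → Joins (S-edge k e′) u v → e ∈ path u → e ∉ path v → e ≡ e′
    crosses 0F            (inj₁ (refl , refl)) here               e∉ = refl
    crosses 0F            (inj₁ (refl , refl)) (there here)       e∉ = contradiction (there here) e∉
    crosses 0F            (inj₁ (refl , refl)) (there (there e∈)) e∉ = contradiction e∈ ∉⊥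
    crosses 0F            (inj₂ (refl , refl)) (there e∈)         e∉ = contradiction (there e∈) e∉
    crosses 1F            (inj₁ (refl , refl)) (there here)       e∉ = refl
    crosses 1F            (inj₁ (refl , refl)) (there (there e∈)) e∉ = contradiction e∈ ∉⊥
    crosses 1F            (inj₂ (refl , refl)) e∈                 e∉ = contradiction e∈ ∉⊥
    crosses (suc (suc i)) (inj₁ (refl , refl)) e∈                 e∉ = contradiction e∈ ∉⊥
    crosses (suc (suc i)) (inj₂ (refl , refl)) (there (there e∈)) e∉ = cong (λ i → suc (suc i)) (x∈⁅y⁆⇒x≡y i e∈)

    -- Whether `e` belongs to the path to the centre tells on which side of `e` a vertex lies, and a
    -- walk can change sides only by traversing `e`.
    separates : ∀ {F e u v} → e ∈ path u → e ∉ path v → Star (Adjacent (S k) F) u v → e ∈ F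
    separates e∈u e∉v ε = contradiction e∈u e∉v
    separates {e = e} e∈u e∉v (_◅_ {j = w} (e′ , e′∈F , joins) walk) with e ∈? path w
    ... | yes e∈w = separates e∈w e∉v walk
    ... | no  e∉w = subst (_∈ _) (sym (crosses e′ joins e∈u e∉w)) e′∈F

    private
      -- For an edge other than e₂, the only vertex whose path to the centre uses it. The edge e₂,
      -- which is `1F`, lies on the paths of both v₀ and v₁, hence the hypothesis `e ≢ 1F` below.
      tip : Fin (4 ℕ.+ k) → Fin (5 ℕ.+ k)
      tip 0F      = 0F
      tip (suc e) = suc (suc e)

    path-tip : ∀ {e} u → e ≢ 1F → e ∈ path u → u ≡ tip e
    path-tip 0F                  e≢1 here               = refl
    path-tip 0F                  e≢1 (there here)       = contradiction refl e≢1
    path-tip 0F                  e≢1 (there (there e∈)) = contradiction e∈ ∉⊥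
    path-tip 1F                  e≢1 (there here)       = contradiction refl e≢1
    path-tip 1F                  e≢1 (there (there e∈)) = contradiction e∈ ∉⊥
    path-tip 2F                  e≢1 e∈                 = contradiction e∈ ∉⊥
    path-tip (suc (suc (suc i))) e≢1 (there (there e∈)) = cong (λ i → suc (suc (suc i))) (sym (x∈⁅y⁆⇒x≡y i e∈))

    e₂∉path : ∀ (v : Fin (5 ℕ.+ k)) → 2 ℕ.≤ toℕ v → 1F ∉ path v
    e₂∉path 2F                  _ e∈ = ∉⊥ e∈
    e₂∉path (suc (suc (suc i))) _ (there ())
    e₂∉path 1F (s≤s ())

    -- Such an edge lies behind a single vertex, so if it is on the path of one vertex of `p`, it
    -- separates this vertex from the other one.
    forced : ∀ {F} (p : 𝒱₂ (5 ℕ.+ k)) {e} → e ≢ 1F →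
      Star (Adjacent (S k) F) (lo p) (hi p) → Star (Adjacent (S k) F) (hi p) (lo p) → e ∈ paths p → e ∈ F
    forced p e≢1 there-walk back e∈ with x∈p∪q⁻ (path (lo p)) (path (hi p)) e∈
    ... | inj₁ e∈lo = separates e∈lo (λ e∈hi → lo≢hi p (trans (path-tip _ e≢1 e∈lo) (sym (path-tip _ e≢1 e∈hi)))) there-walk
    ... | inj₂ e∈hi = separates e∈hi (λ e∈lo → lo≢hi p (trans (path-tip _ e≢1 e∈lo) (sym (path-tip _ e≢1 e∈hi)))) back

    -- For e₂ the two vertices of one pair may lie on the same side. Here `far` helps: it provides a
    -- vertex of the subtree on the side of the centre.
    span⊆subtree : ∀ p q {W F} → 2 ℕ.≤ toℕ (hi p) ⊎ 2 ℕ.≤ toℕ (hi q) →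
      IsSubtreeThrough (S k) p q W F → paths p ∪ paths q ⊆ F
    span⊆subtree p q {W} {F} far (_ , con , (lp , hp) , (lq , hq)) {e} e∈ with e Fin.≟ 1F
    ... | no e≢1 = [ forced p e≢1 (con _ lp _ hp) (con _ hp _ lp) , forced q e≢1 (con _ lq _ hq) (con _ hq _ lq) ]′
                     (x∈p∪q⁻ (paths p) (paths q) e∈)
    ... | yes refl = [ [ reach lp , reach hp ]′ ∘ x∈p∪q⁻ (path (lo p)) _ , [ reach lq , reach hq ]′ ∘ x∈p∪q⁻ (path (lo q)) _ ]′
                       (x∈p∪q⁻ (paths p) (paths q) e∈)
      where
      reach : ∀ {u} → u ∈ W → 1F ∈ path u → 1F ∈ F
      reach u∈W 1∈u = [ (λ 2≤ → separates 1∈u (e₂∉path _ 2≤) (con _ u∈W _ hp))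
                      , (λ 2≤ → separates 1∈u (e₂∉path _ 2≤) (con _ u∈W _ hq)) ]′ far

    -- These are the edge sets in which every edge is connected to the centre: e₁ is the only edge
    -- not incident with v₂, and it needs e₂.
    Closed : Edges → Set
    Closed F = 0F ∈ F → 1F ∈ F

    path-closed : ∀ v → Closed (path v)
    path-closed 0F _ = there here
    path-closed 1F ()
    path-closed 2F ()
    path-closed (suc (suc (suc i))) ()

    ∪-closed : ∀ {F F′} → Closed F → Closed F′ → Closed (F ∪ F′)
    ∪-closed {F} {F′} cl cl′ = [ p⊆p∪q F′ ∘ cl , q⊆p∪q F F′ ∘ cl′ ]′ ∘ x∈p∪q⁻ F F′

    -- The centre v₂ together with the end away from the centre of each edge.
    vertices : Edges → Vertices
    vertices (a ∷ b ∷ L) = a ∷ b ∷ inside ∷ L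

    path⊆⇒∈vertices : ∀ F v → path v ⊆ F → v ∈ vertices F
    path⊆⇒∈vertices (a ∷ b ∷ L) 0F path⊆ with here ← path⊆ here = here
    path⊆⇒∈vertices (a ∷ b ∷ L) 1F path⊆ with there here ← path⊆ (there here) = there here
    path⊆⇒∈vertices (a ∷ b ∷ L) 2F path⊆ = there (there here)
    path⊆⇒∈vertices (a ∷ b ∷ L) (suc (suc (suc i))) path⊆
      with there (there i∈L) ← path⊆ (there (there (x∈⁅x⁆ i))) = there (there (there i∈L))

    vertices-subgraph : ∀ F → Closed F → IsSubgraph (S k) (vertices F) F
    vertices-subgraph (a ∷ b ∷ L) cl 0F here with there here ← cl here = here , there here
    vertices-subgraph (a ∷ b ∷ L) cl 1F (there here) = there here , there (there here)
    vertices-subgraph (a ∷ b ∷ L) cl (suc (suc i)) (there (there i∈L)) = there (there here) , there (there (there i∈L))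

    vertices-connected : ∀ F → Closed F → IsConnected (S k) (vertices F) F
    vertices-connected (a ∷ b ∷ L) cl u u∈ v v∈ = toCentre u u∈ ◅◅ reverse (Adjacent-sym (S k)) (toCentre v v∈)
      where
      F = a ∷ b ∷ L

      toCentre : ∀ u → u ∈ vertices F → Star (Adjacent (S k) F) u 2F
      toCentre 0F here = (0F , here , inj₁ (refl , refl)) ◅ (1F , cl here , inj₁ (refl , refl)) ◅ ε
      toCentre 1F (there here) = (1F , there here , inj₁ (refl , refl)) ◅ ε
      toCentre 2F _ = ε
      toCentre (suc (suc (suc i))) (there (there (there i∈L))) =
        (suc (suc i) , there (there i∈L) , inj₂ (refl , refl)) ◅ ε

    -- The union of the four paths to the centre is itself the edge set of a subtree, and
    -- `span⊆subtree` puts it inside every competitor.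
    𝔇₂-far : ∀ p q → 2 ℕ.≤ toℕ (hi p) ⊎ 2 ℕ.≤ toℕ (hi q) →
      𝔇₂ (S k) (S-connected k) p q ≡ ∣ paths p ∪ paths q ∣
    𝔇₂-far p q far = IsSteinerDistance-unique (S k) p q (𝔇₂-correct (S k) (S-connected k) p q)
      ((vertices F , F , (vertices-subgraph F closed , vertices-connected F closed ,
          (∈F (p⊆p∪q _ ∘ p⊆p∪q _) , ∈F (p⊆p∪q _ ∘ q⊆p∪q (path (lo p)) _)) ,
          (∈F (q⊆p∪q (paths p) _ ∘ p⊆p∪q _) , ∈F (q⊆p∪q (paths p) _ ∘ q⊆p∪q (path (lo q)) _))) , refl)
      , λ { d′ (W , F′ , subtree , refl) → p⊆q⇒∣p∣≤∣q∣ (span⊆subtree p q far subtree) })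
      where
      F : Edges
      F = paths p ∪ paths q

      closed : Closed F
      closed = ∪-closed {paths p} {paths q}
        (∪-closed {path (lo p)} (path-closed (lo p)) (path-closed (hi p)))
        (∪-closed {path (lo q)} (path-closed (lo q)) (path-closed (hi q)))

      ∈F : ∀ {v} → path v ⊆ F → v ∈ vertices F
      ∈F = path⊆⇒∈vertices F _

    e₁-only : ∀ (p : 𝒱₂ (5 ℕ.+ k)) → ¬ 2 ℕ.≤ toℕ (hi p) → lo p ≡ 0F × hi p ≡ 1F
    e₁-only (pair l h l<h) ¬far = lemma l h (recompute (l Fin.<? h) l<h) ¬far
      where
      lemma : ∀ (l h : Fin (5 ℕ.+ k)) → l Fin.< h → ¬ 2 ℕ.≤ toℕ h → l ≡ 0F × h ≡ 1F
      lemma l       0F            () _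
      lemma 0F      1F            _  _    = refl , refl
      lemma (suc l) 1F            (s≤s ()) _
      lemma l       (suc (suc h)) _  ¬far = contradiction (s≤s (s≤s z≤n)) ¬far

    -- Both pairs are e₁, which is a subtree by itself, whereas the paths to the centre would also
    -- include e₂.
    𝔇₂-near : ∀ p q → ¬ 2 ℕ.≤ toℕ (hi p) → ¬ 2 ℕ.≤ toℕ (hi q) → 𝔇₂ (S k) (S-connected k) p q ≡ 1
    𝔇₂-near p q ¬farp ¬farq with e₁-only p ¬farp | e₁-only q ¬farq
    ... | refl , refl | refl , refl =
      IsSteinerDistance-unique (S k) p q (𝔇₂-correct (S k) (S-connected k) p q)
        ((inside ∷ inside ∷ ⊥ , ⁅ 0F ⁆ , (subgraph , connected , (here , there here) , (here , there here)) , ∣⁅x⁆∣≡1 {4 ℕ.+ k} 0F)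
        , λ { d′ (W , F , (_ , con , (0∈W , 1∈W) , _) , refl) →
              ℕₚ.≤-trans (ℕₚ.≤-reflexive (sym (∣⁅x⁆∣≡1 {4 ℕ.+ k} 0F))) (p⊆q⇒∣p∣≤∣q∣ {p = ⁅ 0F ⁆} λ e∈ →
                subst (_∈ F) (sym (x∈⁅y⁆⇒x≡y 0F e∈)) (separates {u = 0F} {v = 1F} here (λ ()) (con 0F 0∈W 1F 1∈W))) })
      where
      subgraph : IsSubgraph (S k) (inside ∷ inside ∷ ⊥) ⁅ 0F ⁆
      subgraph 0F      here       = here , there here
      subgraph (suc e) (there e∈) = contradiction e∈ ∉⊥

      connected : IsConnected (S k) (inside ∷ inside ∷ ⊥) ⁅ 0F ⁆
      connected _ here               _ here               = ε
      connected _ here               _ (there here)       = (0F , here , inj₁ (refl , refl)) ◅ ε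
      connected _ (there here)       _ here               = (0F , here , inj₂ (refl , refl)) ◅ ε
      connected _ (there here)       _ (there here)       = ε
      connected _ (there (there u∈)) _ _                  = contradiction u∈ ∉⊥
      connected _ _                  _ (there (there v∈)) = contradiction v∈ ∉⊥

    far? : ∀ (p q : 𝒱₂ (5 ℕ.+ k)) → Dec (2 ℕ.≤ toℕ (hi p) ⊎ 2 ℕ.≤ toℕ (hi q))
    far? p q = (2 ℕ.≤? toℕ (hi p)) ⊎-dec (2 ℕ.≤? toℕ (hi q))

    distance : 𝒱₂ (5 ℕ.+ k) → 𝒱₂ (5 ℕ.+ k) → ℕ
    distance p q = if does (far? p q) then ∣ paths p ∪ paths q ∣ else 1

    𝔇₂≡distance : ∀ p q → 𝔇₂ (S k) (S-connected k) p q ≡ distance p q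
    𝔇₂≡distance p q = byCases (far? p q)
      where
      byCases : (d : Dec _) → 𝔇₂ (S k) (S-connected k) p q ≡ (if does d then ∣ paths p ∪ paths q ∣ else 1)
      byCases (yes far) = 𝔇₂-far p q far
      byCases (no ¬far) = 𝔇₂-near p q (¬far ∘ inj₁) (¬far ∘ inj₂)

  -- Dependence of the distances on the number of leaves.

  ∣++∣ : ∀ {m n} (p : Subset m) (q : Subset n) → ∣ p ++ q ∣ ≡ ∣ p ∣ ℕ.+ ∣ q ∣
  ∣++∣ []            q = refl
  ∣++∣ (inside  ∷ p) q = cong suc (∣++∣ p q)
  ∣++∣ (outside ∷ p) q = ∣++∣ p q

  ∪-++ : ∀ {m n} (p p′ : Subset m) (q q′ : Subset n) → (p ++ q) ∪ (p′ ++ q′) ≡ (p ∪ p′) ++ (q ∪ q′)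
  ∪-++ p p′ q q′ = zipWith-++ _∨_ p q p′ q′

  ∣⁅x⁆∪⁅y⁆∣≡2 : ∀ {n} {x y : Fin n} → x ≢ y → ∣ ⁅ x ⁆ ∪ ⁅ y ⁆ ∣ ≡ 2
  ∣⁅x⁆∪⁅y⁆∣≡2 {x = zero}  {zero}  x≢y = contradiction refl x≢y
  ∣⁅x⁆∪⁅y⁆∣≡2 {x = zero}  {suc y} x≢y = cong suc (trans (cong ∣_∣ (∪-identityˡ ⁅ y ⁆)) (∣⁅x⁆∣≡1 y))
  ∣⁅x⁆∪⁅y⁆∣≡2 {x = suc x} {zero}  x≢y = cong suc (trans (cong ∣_∣ (∪-identityʳ ⁅ x ⁆)) (∣⁅x⁆∣≡1 x))
  ∣⁅x⁆∪⁅y⁆∣≡2 {x = suc x} {suc y} x≢y = ∣⁅x⁆∪⁅y⁆∣≡2 (x≢y ∘ cong suc)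

  embed : ∀ k → 𝒱₂ 5 → 𝒱₂ (5 ℕ.+ k)
  embed k (pair l h l<h) = pair (l ↑ˡ k) (h ↑ˡ k)
    (subst₂ ℕ._<_ (sym (Finₚ.toℕ-↑ˡ l k)) (sym (Finₚ.toℕ-↑ˡ h k)) l<h)

  leafEdge : ∀ {k} → Fin k → 𝒱₂ (5 ℕ.+ k)
  leafEdge j = pair 2F (5 ↑ʳ j) (s<s (s<s z<s))

  path-↑ˡ : ∀ {k} (v : Fin 5) → path (v ↑ˡ k) ≡ path v ++ ⊥
  path-↑ˡ 0F = refl
  path-↑ˡ 1F = refl
  path-↑ˡ 2F = refl
  path-↑ˡ 3F = refl
  path-↑ˡ 4F = refl

  paths-embed : ∀ {k} p → paths (embed k p) ≡ paths p ++ ⊥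
  paths-embed {k} p = begin
    path (lo p ↑ˡ k) ∪ path (hi p ↑ˡ k)      ≡⟨ cong₂ _∪_ (path-↑ˡ (lo p)) (path-↑ˡ (hi p)) ⟩
    (path (lo p) ++ ⊥) ∪ (path (hi p) ++ ⊥)  ≡⟨ ∪-++ (path (lo p)) (path (hi p)) ⊥ ⊥ ⟩
    paths p ++ (⊥ ∪ ⊥)                       ≡⟨ cong (paths p ++_) (∪-idem ⊥) ⟩
    paths p ++ ⊥                             ∎
    where open ≡-Reasoning

  paths-leafEdge : ∀ {k} (j : Fin k) → paths (leafEdge j) ≡ ⊥ {4} ++ ⁅ j ⁆
  paths-leafEdge j = ∪-identityˡ (⊥ {4} ++ ⁅ j ⁆)

  span-++ : ∀ {k} (p q : 𝒱₂ (5 ℕ.+ k)) (a b : Subset 4) a′ b′ → paths p ≡ a ++ a′ → paths q ≡ b ++ b′ →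
    ∣ paths p ∪ paths q ∣ ≡ ∣ a ∪ b ∣ ℕ.+ ∣ a′ ∪ b′ ∣
  span-++ p q a b a′ b′ p≡ q≡ =
    trans (cong ∣_∣ (trans (cong₂ _∪_ p≡ q≡) (∪-++ a b a′ b′))) (∣++∣ (a ∪ b) (a′ ∪ b′))

  -- The added leaf edges lie on none of the paths, so the distance is that in the tree on five
  -- vertices, where it computes to a numeral for given pairs.
  distance-embed : ∀ {k} p q → distance (embed k p) (embed k q) ≡ distance p q
  distance-embed {k} p q = cong₂ (if_then_else 1)
    (cong₂ (λ a b → does (2 ℕ.≤? a) ∨ does (2 ℕ.≤? b)) (Finₚ.toℕ-↑ˡ (hi p) k) (Finₚ.toℕ-↑ˡ (hi q) k))
    (begin
      ∣ paths (embed k p) ∪ paths (embed k q) ∣  ≡⟨ span-++ (embed k p) (embed k q) (paths p) (paths q) ⊥ ⊥ (paths-embed p) (paths-embed q) ⟩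
      ∣ paths p ∪ paths q ∣ ℕ.+ ∣ ⊥ {k} ∪ ⊥ ∣     ≡⟨ cong (∣ paths p ∪ paths q ∣ ℕ.+_) (trans (cong ∣_∣ (∪-idem (⊥ {k}))) (∣⊥∣≡0 k)) ⟩
      ∣ paths p ∪ paths q ∣ ℕ.+ 0                 ≡⟨ ℕₚ.+-identityʳ _ ⟩
      ∣ paths p ∪ paths q ∣                       ∎)
    where open ≡-Reasoning

  distance-embed-leafEdge : ∀ {k} p (j : Fin k) → distance (embed k p) (leafEdge j) ≡ suc ∣ paths p ∣
  distance-embed-leafEdge {k} p j = begin
    distance (embed k p) (leafEdge j)
      ≡⟨ cong (if_then ∣ paths (embed k p) ∪ paths (leafEdge j) ∣ else 1) (dec-true (far? (embed k p) (leafEdge j)) (inj₂ (s≤s (s≤s z≤n)))) ⟩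
    ∣ paths (embed k p) ∪ paths (leafEdge j) ∣
      ≡⟨ span-++ (embed k p) (leafEdge j) (paths p) ⊥ ⊥ ⁅ j ⁆ (paths-embed p) (paths-leafEdge j) ⟩
    ∣ paths p ∪ ⊥ ∣ ℕ.+ ∣ ⊥ ∪ ⁅ j ⁆ ∣
      ≡⟨ cong₂ ℕ._+_ (cong ∣_∣ (∪-identityʳ (paths p))) (trans (cong ∣_∣ (∪-identityˡ ⁅ j ⁆)) (∣⁅x⁆∣≡1 j)) ⟩
    ∣ paths p ∣ ℕ.+ 1
      ≡⟨ ℕₚ.+-comm _ 1 ⟩
    suc ∣ paths p ∣ ∎
    where open ≡-Reasoning

  distance-leafEdges : ∀ {k} (i j : Fin k) → distance (leafEdge i) (leafEdge j) ≡ (if does (i Fin.≟ j) then 1 else 2)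
  distance-leafEdges i j = trans (span-++ (leafEdge i) (leafEdge j) ⊥ ⊥ ⁅ i ⁆ ⁅ j ⁆ (paths-leafEdge i) (paths-leafEdge j)) (byCases (i Fin.≟ j))
    where
    byCases : (d : Dec (i ≡ j)) → ∣ ⁅ i ⁆ ∪ ⁅ j ⁆ ∣ ≡ (if does d then 1 else 2)
    byCases (yes refl) = trans (cong ∣_∣ (∪-idem ⁅ i ⁆)) (∣⁅x⁆∣≡1 i)
    byCases (no i≢j)   = ∣⁅x⁆∪⁅y⁆∣≡2 i≢j

  -- The edges e₁, …, e₄ and the pairs f₁, f₂ do not change with k, unlike the
  -- leaf edges e₅, …, e_{n-1}, which are indexed by Fin k.
  Index : ℕ → Set
  Index k = Fin 6 ⊎ Fin k

  -- `B₁` and `B₂` list the leaf edges between e₄ and f₁, so the positions from 4 on consist of `k`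
  -- leaf edges followed by f₁ and f₂.
  index : ∀ {k} → Fin (4 ℕ.+ k ℕ.+ 2) → Index k
  index 0F                            = inj₁ 0F
  index 1F                            = inj₁ 1F
  index 2F                            = inj₁ 2F
  index 3F                            = inj₁ 3F
  index {k} (suc (suc (suc (suc i)))) = [ inj₂ , inj₁ ∘ (4 ↑ʳ_) ]′ (splitAt k i)

  private
    unindex : ∀ {k} → Index k → Fin (4 ℕ.+ k ℕ.+ 2)
    unindex (inj₁ 0F) = 0F
    unindex (inj₁ 1F) = 1F
    unindex (inj₁ 2F) = 2F
    unindex (inj₁ 3F) = 3F
    unindex {k} (inj₁ (suc (suc (suc (suc i))))) = suc (suc (suc (suc (k ↑ʳ i))))
    unindex (inj₂ j) = suc (suc (suc (suc (j ↑ˡ 2))))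

    unindex-index : ∀ {k} i → unindex {k} (index i) ≡ i
    unindex-index 0F = refl
    unindex-index 1F = refl
    unindex-index 2F = refl
    unindex-index 3F = refl
    unindex-index {k} (suc (suc (suc (suc i)))) = trans (by-side (splitAt k i)) (cong (λ i → suc (suc (suc (suc i)))) (Finₚ.join-splitAt k 2 i))
      where
      by-side : ∀ s → unindex ([ inj₂ , inj₁ ∘ (4 ↑ʳ_) ]′ s) ≡ suc (suc (suc (suc (Fin.join k 2 s))))
      by-side (inj₁ j) = refl
      by-side (inj₂ f) = refl

  index-injective : ∀ {k} {i j : Fin (4 ℕ.+ k ℕ.+ 2)} → index i ≡ index j → i ≡ j
  index-injective {i = i} {j} eq = trans (sym (unindex-index i)) (trans (cong unindex eq) (unindex-index j))

  -- Position 4 holds the first leaf edge e₅. Removing it is the inductive step of `det-bordered`.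
  index-punchIn : ∀ {k} (i : Fin (4 ℕ.+ k ℕ.+ 2)) → index {suc k} (Fin.punchIn 4F i) ≡ Sum.map₂ suc (index i)
  index-punchIn 0F = refl
  index-punchIn 1F = refl
  index-punchIn 2F = refl
  index-punchIn 3F = refl
  index-punchIn {k} (suc (suc (suc (suc i)))) with splitAt k i
  ... | inj₁ j = refl
  ... | inj₂ f = refl

  module _ (C : Vector (𝒱₂ 5) 6) where

    pairAt : ∀ {k} → Index k → 𝒱₂ (5 ℕ.+ k)
    pairAt {k} (inj₁ a) = embed k (C a)
    pairAt     (inj₂ j) = leafEdge j

    entry : ∀ {k} → Index k → Index k → ℕ
    entry (inj₁ a) (inj₁ b) = distance (C a) (C b)
    entry (inj₁ a) (inj₂ j) = suc ∣ paths (C a) ∣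
    entry (inj₂ i) (inj₁ b) = suc ∣ paths (C b) ∣
    entry (inj₂ i) (inj₂ j) = if does (i Fin.≟ j) then 1 else 2

    𝔇₂≡entry : ∀ {k} (α β : Index k) → 𝔇₂ (S k) (S-connected k) (pairAt α) (pairAt β) ≡ entry α β
    𝔇₂≡entry (inj₁ a) (inj₁ b) = trans (𝔇₂≡distance _ _) (distance-embed (C a) (C b))
    𝔇₂≡entry (inj₁ a) (inj₂ j) = trans (𝔇₂≡distance _ _) (distance-embed-leafEdge (C a) j)
    𝔇₂≡entry (inj₂ i) (inj₁ b) = trans (𝔇₂-sym (S _) (S-connected _) _ _)
      (trans (𝔇₂≡distance _ _) (distance-embed-leafEdge (C b) i))
    𝔇₂≡entry (inj₂ i) (inj₂ j) = trans (𝔇₂≡distance _ _) (distance-leafEdges i j)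

  B₁≡pairAt : ∀ {k} i → B₁ k i ≡ pairAt (B₁ 0) (index i)
  B₁≡pairAt 0F = refl
  B₁≡pairAt 1F = refl
  B₁≡pairAt 2F = refl
  B₁≡pairAt 3F = refl
  B₁≡pairAt {k} (suc (suc (suc (suc i)))) with splitAt k i
  ... | inj₁ j  = refl
  ... | inj₂ 0F = refl
  ... | inj₂ 1F = refl

  B₂≡pairAt : ∀ {k} i → B₂ k i ≡ pairAt (B₂ 0) (index i)
  B₂≡pairAt 0F = refl
  B₂≡pairAt 1F = refl
  B₂≡pairAt 2F = refl
  B₂≡pairAt 3F = refl
  B₂≡pairAt {k} (suc (suc (suc (suc i)))) with splitAt k i
  ... | inj₁ j  = refl
  ... | inj₂ 0F = refl
  ... | inj₂ 1F = refl

open SteinerDistance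

_≟ᵢ_ : ∀ {k} → Decidable {A = Index k} _≡_
_≟ᵢ_ = Sumₚ.≡-dec Fin._≟_ Fin._≟_

-- The characteristic polynomials of the two submatrices.

module CharacteristicPolynomial {c ℓ₁ ℓ₂} (K : HeytingField c ℓ₁ ℓ₂) (_#?_ : Decidable (HeytingField._#_ K)) where

  open OverField K
  open HeytingField K using (_#_; heytingCommutativeRing; tight)
  open HeytingCommutativeRing heytingCommutativeRing using (commutativeRing)
  open CommutativeRing commutativeRing hiding (zero)
  open import Algebra.Properties.Semiring.Exp semiring using (_^_)
  open import Algebra.Properties.Semiring.Mult semiring using (×-homo-+)
  open import Relation.Binary.Reasoning.Setoid setoid
  open Polynomials K
  open Determinant K
  open Solver using (Polynomial; con; var; _:+_; _:*_; _:-_; :-_; _:^_; solve; _:=_) renaming (⟦_⟧ to ⟦_⟧ₚ)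

  bordered : ∀ {k} → SquareMatrix 6 → Vector Carrier 6 → Vector Carrier 6 → Carrier → Index k → Index k → Carrier
  bordered P w r y (inj₁ a) (inj₁ b) = P a b
  bordered P w r y (inj₁ a) (inj₂ j) = w a
  bordered P w r y (inj₂ i) (inj₁ b) = r b
  bordered P w r y (inj₂ i) (inj₂ j) = if does (i Fin.≟ j) then y else 0#

  -- For n = 5 there is no diagonal block. An arbitrary `z ≈ 0#` brings this case into the shape of
  -- the general formula even when `y` has no inverse.
  det-bordered-zero : ∀ P w r y z → z ≈ 0# →
    Det (λ i j → bordered {0} P w r y (index i) (index j)) ≈ Det (λ a b → P a b - z * (w a * r b))
  det-bordered-zero P w r y z z≈0 = Det-cong λ i j →
    trans (reflexive (≡.cong₂ (bordered P w r y) (index₀ i) (index₀ j)))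
      (sym (trans (+-congˡ (-‿cong (trans (*-congʳ z≈0) (zeroˡ _))))
        (solve 1 (λ a → a :- con (+ 0) := a) refl (P i j))))
    where
    index₀ : ∀ i → index {0} i ≡ inj₁ i
    index₀ 0F = ≡.refl
    index₀ 1F = ≡.refl
    index₀ 2F = ≡.refl
    index₀ 3F = ≡.refl
    index₀ 4F = ≡.refl
    index₀ 5F = ≡.refl

  -- The column of the first leaf edge is zero in the other leaf rows, and its row is zero in the
  -- other leaf columns. Its Schur complement therefore changes only the block `P`, by the same
  -- rank-one term each time.
  det-bordered : ∀ k P w r {y p} → y * p ≈ 1# →
    Det (λ i j → bordered {k} P w r y (index i) (index j)) ≈ y ^ k * Det (λ a b → P a b - (⟦ k ⟧ * p) * (w a * r b))
  det-bordered zero    P w r {y} {p} yp≈1 =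
    trans (det-bordered-zero P w r y (0# * p) (zeroˡ p)) (sym (*-identityˡ _))
  det-bordered (suc k) P w r {y} {p} yp≈1 = begin
    Det A
      ≈⟨ Det-schur A 4F 4F p yp≈1 ⟩
    -- The pivot is in row 4 and column 4.
    sgn 8 * (y * Det (schur A 4F 4F p))
      ≈⟨ solve 2 (λ y d → (:- :1) :^ 8 :* (y :* d) := y :* d) refl y _ ⟩
    y * Det (schur A 4F 4F p)
      ≈⟨ *-congˡ (Det-cong λ i j → trans
           (reflexive (≡.cong₂ (λ α β → A⁺ α β - A⁺ α (inj₂ 0F) * p * A⁺ (inj₂ 0F) β) (index-punchIn i) (index-punchIn j)))
           (step (index i) (index j))) ⟩
    y * Det (λ i j → bordered {k} P′ w r y (index i) (index j))
      ≈⟨ *-congˡ (det-bordered k P′ w r yp≈1) ⟩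
    y * (y ^ k * Det (λ a b → P′ a b - (⟦ k ⟧ * p) * (w a * r b)))
      ≈⟨ *-assoc _ _ _ ⟨
    y ^ suc k * Det (λ a b → P′ a b - (⟦ k ⟧ * p) * (w a * r b))
      ≈⟨ *-congˡ (Det-cong λ a b → solve 5 (λ P w p r k →
           P :- w :* p :* r :- (k :* p) :* (w :* r) := P :- ((:1 :+ k) :* p) :* (w :* r)) refl (P a b) (w a) p (r b) ⟦ k ⟧) ⟩
    y ^ suc k * Det (λ a b → P a b - (⟦ suc k ⟧ * p) * (w a * r b)) ∎
    where
    A⁺ : Index (suc k) → Index (suc k) → Carrier
    A⁺ = bordered P w r y

    A : SquareMatrix (5 ℕ.+ k ℕ.+ 2)
    A i j = A⁺ (index i) (index j)

    P′ : SquareMatrix 6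
    P′ a b = P a b - w a * p * r b

    step : ∀ (α β : Index k) →
      A⁺ (Sum.map₂ suc α) (Sum.map₂ suc β) - A⁺ (Sum.map₂ suc α) (inj₂ 0F) * p * A⁺ (inj₂ 0F) (Sum.map₂ suc β)
        ≈ bordered P′ w r y α β
    step (inj₁ a) (inj₁ b) = refl
    step (inj₁ a) (inj₂ j) = solve 2 (λ w p → w :- w :* p :* con (+ 0) := w) refl (w a) p
    step (inj₂ i) (inj₁ b) = solve 2 (λ r p → r :- con (+ 0) :* p :* r := r) refl (r b) p
    step (inj₂ i) (inj₂ j) = solve 2 (λ e p → e :- con (+ 0) :* p :* con (+ 0) := e) refl _ p

  -- `:p` stands for the inverse of x + 1 but is a free variable for the normaliser, and `:κ` is the
  -- number of leaf edges from e₅ on.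
  :x :n :p :κ : Polynomial 3
  :x = var 0F
  :n = var 1F
  :p = var 2F
  :κ = :n :- con (+ 5)

  module Core (C : Vector (𝒱₂ 5) 6) where

    charEntry : ∀ {k} → Carrier → Index k → Index k → Carrier
    charEntry x α β = x * (if does (α ≟ᵢ β) then 1# else 0#) - ⟦ entry C α β ⟧

    charPoly-index : ∀ {k} (B : Vector (𝒱₂ (5 ℕ.+ k)) (4 ℕ.+ k ℕ.+ 2)) → (∀ i → B i ≡ pairAt C (index i)) → ∀ x →
      charPoly (fromℕ-matrix (𝔇₂ (S k) (S-connected k) [ B ])) x ≈ Det (λ i j → charEntry x (index i) (index j))
    charPoly-index {k} B B≡ x = trans (charPoly≈Det _ x) (Det-cong λ i j → reflexive (≡.cong₂ (λ e d → x * (if e then 1# else 0#) - ⟦ d ⟧)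
      (does-⇔ (mk⇔ (≡.cong index) index-injective) (i Fin.≟ j) (index i ≟ᵢ index j))
      (≡.trans (≡.cong₂ (𝔇₂ (S k) (S-connected k)) (B≡ i) (B≡ j)) (𝔇₂≡entry C (index i) (index j)))))

    leaf : Vector ℕ 6
    leaf a = suc ∣ paths (C a) ∣

    P : Carrier → SquareMatrix 6
    P x a b = x * identity a b - ⟦ distance (C a) (C b) ⟧

    -- The term `x * 0#` makes `w` agree judgementally with `charEntry`. Since `3F` is e₄, `r` is a
    -- leaf row minus the row of e₄.
    w r : Carrier → Vector Carrier 6
    w x a = x * 0# - ⟦ leaf a ⟧
    r x b = w x b - P x 3F b

    -- Subtract the row of e₄ from each leaf row. By `leaf 3F ≡ 2`, its entries in the leaf columns
    -- are the off-diagonal entries -2 of the leaf block, so there only x - 1 + 2 = x + 1 on the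
    -- diagonal remains.
    det-charEntry : leaf 3F ≡ 2 → ∀ k x →
      Det (λ i j → charEntry {k} x (index i) (index j)) ≈
      Det (λ i j → bordered {k} (P x) (w x) (r x) (x - - 1#) (index i) (index j))
    det-charEntry leaf₃ k x = trans
      (sym (Det-addRow (λ i j → charEntry {k} x (index i) (index j)) 3F (t ∘ index) refl))
      (Det-cong λ i j → cases (index i) (index j))
      where
      t : Index k → Carrier
      t (inj₁ _) = 0#
      t (inj₂ _) = - 1#

      diagonal : ∀ e → x * (if e then 1# else 0#) - ⟦ if e then 1 else 2 ⟧ + - 1# * (x * 0# - ⟦ 2 ⟧) ≈ (if e then x - - 1# else 0#)
      diagonal true  = solve 1 (λ x → x :* :1 :- con (+ 1) :+ :- :1 :* (x :* con (+ 0) :- con (+ 2)) := x :- :- :1) refl x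
      diagonal false = solve 1 (λ x → x :* con (+ 0) :- con (+ 2) :+ :- :1 :* (x :* con (+ 0) :- con (+ 2)) := con (+ 0)) refl x

      cases : ∀ α β → charEntry x α β + t α * charEntry x (inj₁ 3F) β ≈ bordered (P x) (w x) (r x) (x - - 1#) α β
      cases (inj₁ a) (inj₁ b) = trans (+-congˡ (zeroˡ _)) (+-identityʳ _)
      cases (inj₁ a) (inj₂ j) = trans (+-congˡ (zeroˡ _)) (+-identityʳ _)
      cases (inj₂ i) (inj₁ b) = +-congˡ (solve 1 (λ p → :- :1 :* p := :- p) refl (P x 3F b))
      cases (inj₂ i) (inj₂ j) = trans
        (+-congˡ (*-congˡ (+-congˡ (-‿cong (reflexive (≡.cong ⟦_⟧ leaf₃))))))
        (diagonal (does (i Fin.≟ j)))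

    :P : Fin 6 → Fin 6 → Polynomial 3
    :P a b = :x :* (if does (a Fin.≟ b) then :1 else con (+ 0)) :- con (+ distance (C a) (C b))

    :w :r : Vector (Polynomial 3) 6
    :w a = :x :* con (+ 0) :- con (+ leaf a)
    :r b = :w b :- :P 3F b

    :reduced : Fin 6 → Fin 6 → Polynomial 3
    :reduced a b = :P a b :- (:κ :* :p) :* (:w a :* :r b)

    det-reduced : ∀ t → (∀ ρ → Det (λ a b → ⟦ :reduced a b ⟧ₚ ρ) ≈ ⟦ t ⟧ₚ ρ) → ∀ k x p →
      Det (λ a b → P x a b - (⟦ k ⟧ * p) * (w x a * r x b)) ≈ ⟦ t ⟧ₚ (x ∷ ⟦ 5 ℕ.+ k ⟧ ∷ p ∷ [])
    det-reduced t eq k x p = trans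
      (Det-cong λ a b → +-cong (P≈ a b) (-‿cong (*-cong (*-congʳ κ≈) (*-congˡ (+-congˡ (-‿cong (P≈ 3F b)))))))
      (eq ρ)
      where
      ρ = x ∷ ⟦ 5 ℕ.+ k ⟧ ∷ p ∷ []

      κ≈ : ⟦ k ⟧ ≈ ⟦ 5 ℕ.+ k ⟧ - ⟦ 5 ⟧
      κ≈ = trans (solve 1 (λ k → k := con (+ 5) :+ k :- con (+ 5)) refl ⟦ k ⟧) (+-congʳ (sym (×-homo-+ 1# 5 k)))

      P≈ : ∀ a b → P x a b ≈ ⟦ :P a b ⟧ₚ ρ
      P≈ a b = +-congʳ (*-congˡ (reflexive (≡.sym (if-float (λ e → ⟦ e ⟧ₚ ρ) (does (a Fin.≟ b))))))

    module _ (leaf₃ : leaf 3F ≡ 2)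
      (degenerate : ∀ k x → x - - 1# ≈ 0# → Det (λ i j → charEntry {suc k} x (index i) (index j)) ≈ 0#)
      (h : ℕ → Carrier → Carrier) (q : Carrier → Carrier)
      (reduced : ∀ k x p → Det (λ a b → P x a b - (⟦ k ⟧ * p) * (w x a * r x b)) ≈
        h (5 ℕ.+ k) x + (⟦ 5 ℕ.+ k ⟧ - ⟦ 5 ⟧) * ((p * (x - - 1#) - 1#) * q x)) where

      -- If `y` is invertible, the correction term vanishes because `p * y ≈ 1#`. If `y` is zero and
      -- n = 5, it vanishes because of its factor n - 5, so `p` may be taken to be zero. If `y` is
      -- zero and n > 5, both sides vanish.
      det-charEntry-h : ∀ k x →
        Det (λ i j → charEntry {k} x (index i) (index j)) ≈ (x - - 1#) ^ k * h (5 ℕ.+ k) x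
      det-charEntry-h k x = byCases k ((x - - 1#) #? 0#)
        where
        y = x - - 1#

        byCases : ∀ k → Dec (y # 0#) →
          Det (λ i j → charEntry {k} x (index i) (index j)) ≈ y ^ k * h (5 ℕ.+ k) x
        byCases k (yes y#0) = let p , yp≈1 = #0⇒inverse y#0 in begin
          Det (λ i j → charEntry {k} x (index i) (index j))
            ≈⟨ det-charEntry leaf₃ k x ⟩
          Det (λ i j → bordered {k} (P x) (w x) (r x) y (index i) (index j))
            ≈⟨ det-bordered k (P x) (w x) (r x) yp≈1 ⟩
          y ^ k * Det (λ a b → P x a b - (⟦ k ⟧ * p) * (w x a * r x b))
            ≈⟨ *-congˡ (reduced k x p) ⟩
          y ^ k * (h (5 ℕ.+ k) x + (⟦ 5 ℕ.+ k ⟧ - ⟦ 5 ⟧) * ((p * y - 1#) * q x))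
            ≈⟨ *-congˡ (trans (+-congˡ (trans (*-congˡ (trans (*-congʳ
                 (trans (+-congʳ (trans (*-comm p y) yp≈1)) (-‿inverseʳ 1#))) (zeroˡ _))) (zeroʳ _))) (+-identityʳ _)) ⟩
          y ^ k * h (5 ℕ.+ k) x ∎
        byCases zero (no _) = begin
          Det (λ i j → charEntry {0} x (index i) (index j))
            ≈⟨ det-charEntry leaf₃ 0 x ⟩
          Det (λ i j → bordered {0} (P x) (w x) (r x) y (index i) (index j))
            ≈⟨ det-bordered-zero (P x) (w x) (r x) y (0# * 0#) (zeroˡ 0#) ⟩
          Det (λ a b → P x a b - (0# * 0#) * (w x a * r x b))
            ≈⟨ reduced 0 x 0# ⟩
          h 5 x + (⟦ 5 ⟧ - ⟦ 5 ⟧) * ((0# * y - 1#) * q x)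
            ≈⟨ trans (+-congˡ (trans (*-congʳ (-‿inverseʳ ⟦ 5 ⟧)) (zeroˡ _))) (+-identityʳ _) ⟩
          h 5 x
            ≈⟨ *-identityˡ _ ⟨
          1# * h 5 x ∎
        byCases (suc k) (no ¬y#0) = begin
          Det (λ i j → charEntry {suc k} x (index i) (index j))
            ≈⟨ degenerate k x y≈0 ⟩
          0#
            ≈⟨ zeroˡ _ ⟨
          0# * (y ^ k * h (6 ℕ.+ k) x)
            ≈⟨ *-congʳ y≈0 ⟨
          y * (y ^ k * h (6 ℕ.+ k) x)
            ≈⟨ *-assoc _ _ _ ⟨
          y ^ suc k * h (6 ℕ.+ k) x ∎
          where
          y≈0 : y ≈ 0#
          y≈0 = proj₁ (tight _ _) ¬y#0

  eigenvaluesAre-h : ∀ {k} (B : Vector (𝒱₂ (5 ℕ.+ k)) (4 ℕ.+ k ℕ.+ 2)) h →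
    (∀ x → charPoly (fromℕ-matrix (𝔇₂ (S k) (S-connected k) [ B ])) x ≈ (x - - 1#) ^ k * h x) →
    EigenvaluesAre (fromℕ-matrix (𝔇₂ (S k) (S-connected k) [ B ])) (- 1#) k h
  eigenvaluesAre-h {k} B h = Eigenvalues.charPoly⇒eigenvaluesAre K _#?_ _
    (λ i j → reflexive (≡.cong ⟦_⟧ (𝔇₂-sym (S k) (S-connected k) (B i) (B j)))) (- 1#) k h

  module C₁ = Core (B₁ 0)
  module C₂ = Core (B₂ 0)

  -- At x = -1 the diagonal entry x - 1 becomes -2, which is the entry of two different leaf edges.
  twin : ∀ x → x - - 1# ≈ 0# → x * 1# - ⟦ 1 ⟧ ≈ x * 0# - ⟦ 2 ⟧
  twin x y≈0 = begin
    x * 1# - ⟦ 1 ⟧                 ≈⟨ solve 1 (λ x → x :* :1 :- con (+ 1) := (x :* con (+ 0) :- con (+ 2)) :+ (x :- :- :1)) refl x ⟩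
    (x * 0# - ⟦ 2 ⟧) + (x - - 1#)  ≈⟨ +-congˡ y≈0 ⟩
    (x * 0# - ⟦ 2 ⟧) + 0#          ≈⟨ +-identityʳ _ ⟩
    x * 0# - ⟦ 2 ⟧                 ∎

  -- In `B₁` the pair f₂ involves v₃ but not v₄, so e₄ and e₅ have the same distances to all other
  -- pairs.
  degenerate₁ : ∀ k x → x - - 1# ≈ 0# → Det (λ i j → C₁.charEntry {suc k} x (index i) (index j)) ≈ 0#
  degenerate₁ k x y≈0 = Det-equalRows (λ i j → C₁.charEntry {suc k} x (index i) (index j)) {3F} {4F} (λ ()) (λ j → rows (index j))
    where
    rows : ∀ (β : Index (suc k)) → C₁.charEntry x (inj₁ 3F) β ≈ C₁.charEntry x (inj₂ 0F) β
    rows (inj₁ 0F)      = refl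
    rows (inj₁ 1F)      = refl
    rows (inj₁ 2F)      = refl
    rows (inj₁ 3F)      = twin x y≈0
    rows (inj₁ 4F)      = refl
    rows (inj₁ 5F)      = refl
    rows (inj₂ 0F)      = sym (twin x y≈0)
    rows (inj₂ (suc j)) = refl

  -- In `B₂` the pair f₂ distinguishes e₄ from e₅, but it treats e₃ and e₄ alike, so the rows of
  -- these two are compared.
  degenerate₂ : ∀ k x → x - - 1# ≈ 0# → Det (λ i j → C₂.charEntry {suc k} x (index i) (index j)) ≈ 0#
  degenerate₂ k x y≈0 = Det-equalRows (λ i j → C₂.charEntry {suc k} x (index i) (index j)) {2F} {3F} (λ ()) (λ j → rows (index j))
    where
    rows : ∀ (β : Index (suc k)) → C₂.charEntry x (inj₁ 2F) β ≈ C₂.charEntry x (inj₁ 3F) β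
    rows (inj₁ 0F) = refl
    rows (inj₁ 1F) = refl
    rows (inj₁ 2F) = twin x y≈0
    rows (inj₁ 3F) = sym (twin x y≈0)
    rows (inj₁ 4F) = refl
    rows (inj₁ 5F) = refl
    rows (inj₂ j)  = refl

  -- `:h₁` and `:h₂` follow `h₁` and `h₂` operation by operation, so that they evaluate to them
  -- judgementally.
  :h₁ :h₂ :q₁ :q₂ : Polynomial 3
  :h₁ = :x :^ 6
    :- con (+ 2) :* (:n :- :1) :* :x :^ 5
    :- con (+ 3) :* (con (+ 7) :* :n :- con (+ 12)) :* :x :^ 4
    :- con (+ 18) :* (con (+ 3) :* :n :- con (+ 7)) :* :x :^ 3
    :- con (+ 5) :* (con (+ 9) :* :n :- con (+ 22)) :* :x :^ 2
    :- (con (+ 13) :* :n :- con (+ 28)) :* :x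
    :- (:n :- :1)
  :h₂ = :x :^ 6
    :- con (+ 2) :* (:n :- :1) :* :x :^ 5
    :- (con (+ 21) :* :n :- con (+ 22)) :* :x :^ 4
    :- (con (+ 62) :* :n :- con (+ 141)) :* :x :^ 3
    :- (con (+ 53) :* :n :- con (+ 133)) :* :x :^ 2
    :- (con (+ 15) :* :n :- con (+ 34)) :* :x
    :- (:n :- :1)
  :q₁ = :- (con (+ 2) :* :x :^ 5 :+ con (+ 21) :* :x :^ 4 :+ con (+ 54) :* :x :^ 3 :+ con (+ 45) :* :x :^ 2 :+ con (+ 13) :* :x :+ con (+ 1))
  :q₂ = :- (con (+ 2) :* :x :^ 5 :+ con (+ 21) :* :x :^ 4 :+ con (+ 62) :* :x :^ 3 :+ con (+ 53) :* :x :^ 2 :+ con (+ 15) :* :x :+ con (+ 1))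

  -- The last summand vanishes if p is the inverse of x + 1, and also if n = 5;
  -- q is the coefficient of n in h.
  :target : Polynomial 3 → Polynomial 3 → Polynomial 3
  :target h q = h :+ :κ :* ((:p :* (:x :- :- :1) :- :1) :* q)

  -- The update by κ p has rank one, so the determinant is linear in κ p: it is h at n = 5 plus κ p
  -- (x + 1) q. As h is linear in n, its value at n = 5 is h - κ q, which gives the form of
  -- `:target`.
  identity₁ : ∀ ρ → Det (λ a b → ⟦ C₁.:reduced a b ⟧ₚ ρ) ≈ ⟦ :target :h₁ :q₁ ⟧ₚ ρ
  identity₁ = Det-normalise C₁.:reduced (:target :h₁ :q₁) ≡.refl

  identity₂ : ∀ ρ → Det (λ a b → ⟦ C₂.:reduced a b ⟧ₚ ρ) ≈ ⟦ :target :h₂ :q₂ ⟧ₚ ρ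
  identity₂ = Det-normalise C₂.:reduced (:target :h₂ :q₂) ≡.refl

  eigenvalues-B₁ : ∀ k → EigenvaluesAre (fromℕ-matrix (𝔇₂ (S k) (S-connected k) [ B₁ k ])) (- 1#) k (h₁ (5 ℕ.+ k))
  eigenvalues-B₁ k = eigenvaluesAre-h (B₁ k) (h₁ (5 ℕ.+ k)) λ x → trans (C₁.charPoly-index (B₁ k) B₁≡pairAt x)
    -- `:q₁` involves `:x` only, so its value is judgementally the same with zeros in place of n and
    -- p.
    (C₁.det-charEntry-h ≡.refl degenerate₁ h₁ (λ x → ⟦ :q₁ ⟧ₚ (x ∷ 0# ∷ 0# ∷ []))
      (C₁.det-reduced (:target :h₁ :q₁) identity₁) k x)

  eigenvalues-B₂ : ∀ k → EigenvaluesAre (fromℕ-matrix (𝔇₂ (S k) (S-connected k) [ B₂ k ])) (- 1#) k (h₂ (5 ℕ.+ k))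
  eigenvalues-B₂ k = eigenvaluesAre-h (B₂ k) (h₂ (5 ℕ.+ k)) λ x → trans (C₂.charPoly-index (B₂ k) B₂≡pairAt x)
    (C₂.det-charEntry-h ≡.refl degenerate₂ h₂ (λ x → ⟦ :q₂ ⟧ₚ (x ∷ 0# ∷ 0# ∷ []))
      (C₂.det-reduced (:target :h₂ :q₂) identity₂) k x)

open import Data.Nat using (_+_; _∸_)
open HeytingField using (_#_; -_; 1#)
open OverField

theorem5p5 : ∀ {c ℓ₁ ℓ₂} (K : HeytingField c ℓ₁ ℓ₂) →
    Decidable (_#_ K) → CharacteristicZero K →
    (k : ℕ) →
    let n = 5 + k
        D = 𝔇₂ (S k) (S-connected k)
    in
    EigenvaluesAre K (fromℕ-matrix K (D [ B₁ k ])) (-_ K (1# K)) (n ∸ 5) (h₁ K n) ×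
    EigenvaluesAre K (fromℕ-matrix K (D [ B₂ k ])) (-_ K (1# K)) (n ∸ 5) (h₂ K n)
theorem5p5 K _#?_ _ k = eigenvalues-B₁ k , eigenvalues-B₂ k
  where open CharacteristicPolynomial K _#?_ using (eigenvalues-B₁; eigenvalues-B₂)
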